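{- There are infinitely many integers $v$ such that a $vgr(v,k,g,\lambda)$-graph exists in each of the following cases: (i) $\lambda=1$ and all integers $k,g\geq 3$; (ii) $\lambda=2$ and all integers $k\geq 4$, $g\geq 3$; (iii) all integers $\lambda\geq 3$, $k\geq\lambda$, $g\geq 3$ with $g\notin\{4,5\}$.
   Context: A $vgr(v,k,g,\lambda)$-graph is a $k$-regular graph of girth $g$ on $v$ vertices in which every vertex is contained in exactly $\lambda$ cycles of length $g$. -}

module Defs where

open import Data.Nat using (ℕ; zero; suc; _≤_; _<_)
open import Data.Fin using (Fin; toℕ)
open import Data.Fin.Subset using (Subset; _∈_; _∉_; ∣_∣; Nonempty)
open import Data.Vec using (Vec; lookup)
open import Data.Product using (Σ; ∃; _×_; _,_)
open import Data.Sum using (_⊎_)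
open import Function.Bundles using (_⇔_)
open import Relation.Binary.PropositionalEquality using (_≡_; _≢_)
open import Relation.Nullary using (¬_)

-- An edge set on the vertex set Fin v, given as neighbourhoods:
-- b ∈ lookup E a  means  {a,b} is an edge.
EdgeSet : ℕ → Set
EdgeSet v = Vec (Subset v) v

_~[_]_ : ∀ {v} → Fin v → EdgeSet v → Fin v → Set
a ~[ E ] b = b ∈ lookup E a

record Graph (v : ℕ) : Set where
  field
    edges     : EdgeSet v
    symmetric : ∀ a b → a ~[ edges ] b → b ~[ edges ] a
    loopless  : ∀ a → ¬ (a ~[ edges ] a)
open Graph public

degree : ∀ {v} → Graph v → Fin v → ℕ
degree G a = ∣ lookup (edges G) a ∣

Regular : ∀ {v} → ℕ → Graph v → Set
Regular k G = ∀ a → degree G a ≡ k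

Consecutive : (m : ℕ) → Fin m → Fin m → Set
Consecutive m i j = (suc (toℕ i) ≡ toℕ j) ⊎ ((suc (toℕ i) ≡ m) × (toℕ j ≡ 0))

IsCycle : ∀ {v} → Graph v → ℕ → EdgeSet v → Set
IsCycle {v} G m C =
  (3 ≤ m) ×
  (∀ a b → a ~[ C ] b → a ~[ edges G ] b) ×
  Σ (Fin m → Fin v) λ f →
    (∀ i j → f i ≡ f j → i ≡ j) ×
    (∀ a b → (a ~[ C ] b) ⇔
      (∃ λ i → ∃ λ j → Consecutive m i j ×
        (((f i ≡ a) × (f j ≡ b)) ⊎ ((f i ≡ b) × (f j ≡ a)))))

OnCycle : ∀ {v} → Fin v → EdgeSet v → Set
OnCycle a C = Nonempty (lookup C a)

Girth : ∀ {v} → ℕ → Graph v → Set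
Girth g G = (∃ λ C → IsCycle G g C) × (∀ m C → m < g → ¬ IsCycle G m C)

-- vertex a lies on exactly λ' cycles of length g of G
-- (cycles identified with their edge sets).
ExactlyOnCycles : ∀ {v} → ℕ → ℕ → Graph v → Fin v → Set
ExactlyOnCycles {v} λ' g G a =
  Σ (Fin λ' → EdgeSet v) λ cs →
    (∀ i → IsCycle G g (cs i) × OnCycle a (cs i)) ×
    (∀ i j → cs i ≡ cs j → i ≡ j) ×
    (∀ C → IsCycle G g C → OnCycle a C → ∃ λ i → cs i ≡ C)

IsVGR : (v k g λ' : ℕ) → Graph v → Set
IsVGR v k g λ' G = Regular k G × Girth g G × (∀ a → ExactlyOnCycles λ' g G a)

VGRExists : (v k g λ' : ℕ) → Set
VGRExists v k g λ' = Σ (Graph v) (IsVGR v k g λ')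

InfinitelyManyVGR : (k g λ' : ℕ) → Set
InfinitelyManyVGR k g λ' = ∀ N → ∃ λ v → (N ≤ v) × VGRExists v k g λ'

{-# OPTIONS --safe #-}
module Submission where

-- Disjoint unions are allowed, so one graph for each (k, g, λ) is enough.
--
-- For g ≥ 4 take a finite set T on which letters act so that no short reduced
-- word has a fixed point, and the graph on T × ℤ/g with the edges
-- (t , x) – (t , x + 1).  A cut at b, with letter σ, adds the edges
-- (t , b) – (σ t , b + 1) and (t , b + h) – (σ⁻¹ t , b + h + 1), h = ⌊g/2⌋;
-- the degrees are completed by edges (t , x) – (ρ t , x) with involutive
-- letters ρ used at one x only.  The label of a closed walk without
-- backtracking of length at most g is a trivial word, hence contains two
-- neighbouring inverse letters.  These must be the two edges of one cut, which
-- are h apart, so that there is room for only one such pair, and the walk winds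
-- once around ℤ/g: it is a horizontal cycle, or it switches sheets exactly at
-- the two edges of a cut.  This gives 1 + (number of cuts) cycles through every
-- vertex.
--
-- A cut touches four vertices.  Degree k = λ requires that every vertex is
-- missed by one of the λ - 1 cuts, which can be achieved for g ≥ 8, and for
-- g = 6 and 7 if λ ≥ 4.  The two remaining cubic graphs are given explicitly.
-- For g = 3 one takes Cartesian products of complete graphs, octahedra and
-- icosahedra, in which every triangle lies in a fibre.

open import Defs
open import Data.Nat using (ℕ; zero; suc; _+_; _*_; _∸_; _^_; _/_; _≤_; _<_; z≤n; s≤s; z<s; NonZero; >-nonZero; _<ᵇ_; _≡ᵇ_; ⌊_/2⌋)
open import Data.Nat.Properties
open import Data.Nat.DivMod using (_%_; _mod_; m%n<n; m<n⇒m%n≡m; n%n≡0; m%n%n≡m%n; %-distribˡ-+; [m+n]%n≡m%n)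
open import Data.Fin using (Fin; zero; suc; toℕ; fromℕ; fromℕ<; opposite; splitAt; join; _↑ˡ_; _↑ʳ_; #_; combine; remQuot; finToFun; funToFin; punchIn; punchOut; inject≤)
open import Data.Fin.Properties using (toℕ-injective; toℕ<n; toℕ-fromℕ; toℕ-fromℕ<; any?; all?; injective⇒≤; *↔×; opposite-prop; opposite-involutive; splitAt-↑ˡ; splitAt-↑ʳ; splitAt-join; join-splitAt; combine-injective; remQuot-combine; combine-remQuot; finToFun-funToFin; funToFin-finToFin; punchIn-injective; punchInᵢ≢i; punchIn-punchOut; inject≤-injective; toℕ-inject≤)
import Data.Fin.Properties as Fin
open import Data.Fin.Subset using (Subset; inside; outside; ∣_∣) renaming (_∈_ to _∈ₛ_)
open import Data.Fin.Subset.Properties using (⊆-antisym)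
open import Data.Vec using (Vec; []; _∷_; lookup; tabulate; here; there)
import Data.Vec as Vec
open import Data.Vec.Properties using (lookup∘tabulate; tabulate∘lookup; tabulate-cong; []=⇒lookup; lookup⇒[]=)
open import Data.List using (List; []; _∷_; length; _∷ʳ_)
open import Data.List.Properties using (≡-dec; ∷-injective; length-++)
open import Data.Bool using (Bool; true; false; not; _∧_; _∨_; if_then_else_) renaming (T to IsTrue)
open import Data.Bool.Properties using (not-involutive; not-injective)
import Data.Bool.Properties as Bool
open import Data.Maybe using (Maybe; just; nothing)
import Data.Maybe as Maybe
open import Data.Maybe.Properties using (just-injective)
open import Data.Product using (Σ; ∃; _×_; _,_; proj₁; proj₂)
open import Data.Product.Function.NonDependent.Propositional using (_×-↔_)
open import Data.Sum using (_⊎_; inj₁; inj₂; [_,_]′)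
open import Data.Empty using (⊥; ⊥-elim)
open import Data.Unit using (tt)
open import Function.Base using (_∘_; id)
open import Function.Bundles using (mk⇔; Equivalence; _↔_; Inverse)
open import Function.Construct.Composition using (_↔-∘_)
open import Function.Construct.Identity using (↔-id)
open import Function.Construct.Symmetry using (↔-sym)
open import Relation.Binary.Definitions using (tri<; tri≈; tri>)
open import Relation.Binary.PropositionalEquality hiding ([_])
open import Relation.Nullary using (¬_; Dec; yes; no; does; contradiction; ¬?)
open import Relation.Nullary.Decidable using (_×-dec_; _⊎-dec_; _→-dec_; True; toWitness; from-yes; dec-true; dec-false; map′)

-- Congruence of natural numbers

-- Why h = ⌊g/2⌋: two inverse letters at the two edges of a cut, with the stretch between them, take
-- at least h + 1 steps of a walk, and two such pairs would take 2h + 2 > g. A smaller distance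
-- could leave room for a walk through two different cuts, which would be an unwanted g-cycle.
--
-- Why λ = k is tight: with degree k = 2 + r there are two horizontal edges and r further ones, but
-- r + 1 labels, so each vertex drops one label. If all r + 1 labels are cuts, the dropped one must
-- be a cut that does not touch the vertex. A cut at b touches b, b + 1, b + h and b + h + 1, hence
-- misses two residues for g = 6 and three for g = 7. For λ = 3 there are two cuts, and together
-- they miss at most 4 of 6 or 6 of 7 vertices, whereas three cuts can miss them all; for g ≥ 8 two
-- cuts on disjoint sets of vertices are enough.
--
-- The action on T comes from repeated covers that start with the swap of two points; each cover
-- raises the length of the words without fixed points by one.

infix 4 _≈[_]_

_≈[_]_ : ℕ → (g : ℕ) .{{_ : NonZero g}} → ℕ → Set
a ≈[ g ] b = a % g ≡ b % g

module _ {g : ℕ} .{{_ : NonZero g}} where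

  ≈-+ : ∀ {a b c d} → a ≈[ g ] b → c ≈[ g ] d → a + c ≈[ g ] b + d
  ≈-+ {a} {b} {c} {d} p q = begin
    (a + c) % g             ≡⟨ %-distribˡ-+ a c g ⟩
    (a % g + c % g) % g     ≡⟨ cong₂ (λ x y → (x + y) % g) p q ⟩
    (b % g + d % g) % g     ≡⟨ %-distribˡ-+ b d g ⟨
    (b + d) % g             ∎
    where open ≡-Reasoning

  %-≈ : ∀ a → a % g ≈[ g ] a
  %-≈ a = m%n%n≡m%n a g

  ≈-+g : ∀ a → a + g ≈[ g ] a
  ≈-+g a = [m+n]%n≡m%n a g

  ≈-small : ∀ {a b} → a < g → b < g → a ≈[ g ] b → a ≡ b
  ≈-small a<g b<g p = trans (sym (m<n⇒m%n≡m a<g)) (trans p (m<n⇒m%n≡m b<g))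

  ≈-cancelˡ : ∀ c {a b} → c + a ≈[ g ] c + b → a ≈[ g ] b
  ≈-cancelˡ c {a} {b} p = trans (sym (undo a)) (trans (≈-+ {c′} {c′} refl p) (undo b))
    where
    -- The additive inverse of `c` modulo `g`; the subtraction is not truncated, because `c % g`
    -- lies below `g`.
    c′ = g ∸ c % g
    undo : ∀ x → c′ + (c + x) ≈[ g ] x
    undo x = begin
      (c′ + (c + x)) % g      ≡⟨ cong (_% g) (+-assoc c′ c x) ⟨
      (c′ + c + x) % g        ≡⟨ ≈-+ {c′ + c} {g} (trans (≈-+ {c′} {c′} refl (sym (%-≈ c))) (cong (_% g) (m∸n+n≡m (<⇒≤ (m%n<n c g))))) refl ⟩
      (g + x) % g             ≡⟨ cong (_% g) (+-comm g x) ⟩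
      (x + g) % g             ≡⟨ ≈-+g x ⟩
      x % g                   ∎
      where open ≡-Reasoning

  ≈-cancelʳ : ∀ c {a b} → a + c ≈[ g ] b + c → a ≈[ g ] b
  ≈-cancelʳ c {a} {b} p = ≈-cancelˡ c (trans (cong (_% g) (+-comm c a)) (trans p (cong (_% g) (+-comm b c))))

  ≈-wrap : ∀ {a b} → a < g → a < b → b < g + g → a ≈[ g ] b → b ≡ a + g
  ≈-wrap {a} {b} a<g a<b b<2g a≈b with b <? g
  ... | yes b<g = contradiction (≈-small a<g b<g a≈b) (<⇒≢ a<b)
  ... | no b≮g = begin
    b               ≡⟨ m∸n+n≡m g≤b ⟨
    b ∸ g + g       ≡⟨ cong (_+ g) (≈-small a<g c<g (trans a≈b (trans (cong (_% g) (sym (m∸n+n≡m g≤b))) (≈-+g (b ∸ g))))) ⟨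
    a + g           ∎
    where
    open ≡-Reasoning
    g≤b = ≮⇒≥ b≮g
    c<g : b ∸ g < g
    c<g = +-cancelʳ-< g (b ∸ g) g (subst (_< g + g) (sym (m∸n+n≡m g≤b)) b<2g)

  ≈0⇒≡g : ∀ {m} → 0 < m → m ≤ g → m ≈[ g ] 0 → m ≡ g
  ≈0⇒≡g {m} 0<m m≤g m≈0 with m≤n⇒m<n∨m≡n m≤g
  ... | inj₂ m≡g = m≡g
  ... | inj₁ m<g = contradiction (≈-small m<g (≤-<-trans z≤n m<g) m≈0) (λ m≡0 → <⇒≢ 0<m (sym m≡0))

toℕ-mod : ∀ n m .{{_ : NonZero m}} → toℕ (n mod m) ≡ n % m
toℕ-mod n m = toℕ-fromℕ< (m%n<n n m)

mod-cong : ∀ {a b} m .{{_ : NonZero m}} → a ≈[ m ] b → a mod m ≡ b mod m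
mod-cong {a} {b} m p = toℕ-injective (trans (toℕ-mod a m) (trans p (sym (toℕ-mod b m))))

toℕ-mod-id : ∀ {m} .{{_ : NonZero m}} (i : Fin m) → toℕ i mod m ≡ i
toℕ-mod-id {m} i = toℕ-injective (trans (toℕ-mod (toℕ i) m) (m<n⇒m%n≡m (toℕ<n i)))

-- Cyclic sequences

consecutive⇒≈ : ∀ {m} .{{_ : NonZero m}} {i j : Fin m} → Consecutive m i j → suc (toℕ i) ≈[ m ] toℕ j
consecutive⇒≈ {m} (inj₁ p) = cong (_% m) p
consecutive⇒≈ {m} (inj₂ (p , q)) = trans (cong (_% m) p) (trans (n%n≡0 m) (sym (trans (cong (_% m) q) (0%m m))))
  where
  0%m : ∀ m .{{_ : NonZero m}} → 0 % m ≡ 0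
  0%m (suc m) = refl

≈⇒consecutive : ∀ {m} .{{_ : NonZero m}} {i j : Fin m} → suc (toℕ i) ≈[ m ] toℕ j → Consecutive m i j
≈⇒consecutive {suc m} {i} {j} p with m≤n⇒m<n∨m≡n (toℕ<n i)
... | inj₁ si<m = inj₁ (≈-small si<m (toℕ<n j) p)
... | inj₂ si≡m = inj₂ (si≡m , sym (≈-small z<s (toℕ<n j) (trans (sym (trans (cong (_% suc m) si≡m) (n%n≡0 (suc m)))) p)))

mod-consecutive : ∀ n m .{{_ : NonZero m}} → Consecutive m (n mod m) (suc n mod m)
mod-consecutive n m = ≈⇒consecutive (begin
  suc (toℕ (n mod m)) % m   ≡⟨ cong (λ x → suc x % m) (toℕ-mod n m) ⟩
  suc (n % m) % m           ≡⟨ ≈-+ {a = 1} refl (%-≈ n) ⟩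
  suc n % m                 ≡⟨ %-≈ (suc n) ⟨
  suc n % m % m             ≡⟨ cong (_% m) (toℕ-mod (suc n) m) ⟨
  toℕ (suc n mod m) % m     ∎)
  where open ≡-Reasoning

consecutive⇒mod : ∀ {m} .{{_ : NonZero m}} {i j : Fin m} → Consecutive m i j → j ≡ suc (toℕ i) mod m
consecutive⇒mod {m} {i} {j} c = trans (sym (toℕ-mod-id j)) (mod-cong m (sym (consecutive⇒≈ c)))

module _ {V : Set} where

  -- The condition that `IsCycle` imposes on its edge set, word for word, but on any vertex type;
  -- `_≋_` below is then equality of cycles in the sense of the theorem, free of base point and
  -- direction.
  EdgeOf : ∀ {m} → (Fin m → V) → V → V → Set
  EdgeOf {m} f a b = ∃ λ i → ∃ λ j → Consecutive m i j ×
    (((f i ≡ a) × (f j ≡ b)) ⊎ ((f i ≡ b) × (f j ≡ a)))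

  infix 4 _⊑_ _≋_

  _⊑_ : ∀ {m n} → (Fin m → V) → (Fin n → V) → Set
  f ⊑ f′ = ∀ a b → EdgeOf f a b → EdgeOf f′ a b

  _≋_ : ∀ {m n} → (Fin m → V) → (Fin n → V) → Set
  f ≋ f′ = f ⊑ f′ × f′ ⊑ f

  ≋-trans : ∀ {l m n} {f : Fin l → V} {f′ : Fin m → V} {f″ : Fin n → V} → f ≋ f′ → f′ ≋ f″ → f ≋ f″
  ≋-trans (p , q) (p′ , q′) = (λ a b → p′ a b ∘ p a b) , (λ a b → q a b ∘ q′ a b)

  ⊑-reflexive : ∀ {m} {f f′ : Fin m → V} → (∀ i → f i ≡ f′ i) → f ⊑ f′
  ⊑-reflexive e a b (i , j , c , inj₁ (p , q)) = i , j , c , inj₁ (trans (sym (e i)) p , trans (sym (e j)) q)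
  ⊑-reflexive e a b (i , j , c , inj₂ (p , q)) = i , j , c , inj₂ (trans (sym (e i)) p , trans (sym (e j)) q)

  ≗⇒≋ : ∀ {m} {f f′ : Fin m → V} → (∀ i → f i ≡ f′ i) → f ≋ f′
  ≗⇒≋ e = ⊑-reflexive e , ⊑-reflexive (sym ∘ e)

  ⊑-along : ∀ {m n} {f : Fin m → V} {f′ : Fin n → V} (φ : Fin m → Fin n) →
    (∀ {i j} → Consecutive m i j → Consecutive n (φ i) (φ j)) → (∀ i → f i ≡ f′ (φ i)) → f ⊑ f′
  ⊑-along φ cons e a b (i , j , c , inj₁ (p , q)) = φ i , φ j , cons c , inj₁ (trans (sym (e i)) p , trans (sym (e j)) q)
  ⊑-along φ cons e a b (i , j , c , inj₂ (p , q)) = φ i , φ j , cons c , inj₂ (trans (sym (e i)) p , trans (sym (e j)) q)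

  ⊑-reversing : ∀ {m n} {f : Fin m → V} {f′ : Fin n → V} (φ : Fin m → Fin n) →
    (∀ {i j} → Consecutive m i j → Consecutive n (φ j) (φ i)) → (∀ i → f i ≡ f′ (φ i)) → f ⊑ f′
  ⊑-reversing φ cons e a b (i , j , c , inj₁ (p , q)) = φ j , φ i , cons c , inj₂ (trans (sym (e j)) q , trans (sym (e i)) p)
  ⊑-reversing φ cons e a b (i , j , c , inj₂ (p , q)) = φ j , φ i , cons c , inj₁ (trans (sym (e j)) q , trans (sym (e i)) p)

shift : ∀ {m} .{{_ : NonZero m}} → ℕ → Fin m → Fin m
shift {m} r i = (r + toℕ i) mod m

shift-consecutive : ∀ {m} .{{_ : NonZero m}} r {i j : Fin m} → Consecutive m i j → Consecutive m (shift r i) (shift r j)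
shift-consecutive {m} r {i} {j} c =
  subst (Consecutive m (shift r i)) (mod-cong m eq) (mod-consecutive (r + toℕ i) m)
  where
  eq : suc (r + toℕ i) ≈[ m ] r + toℕ j
  eq = trans (cong (_% m) (sym (+-suc r (toℕ i)))) (≈-+ {a = r} refl (consecutive⇒≈ c))

shift-+ : ∀ {m} .{{_ : NonZero m}} r s (i : Fin m) → shift r (shift s i) ≡ shift (r + s) i
shift-+ {m} r s i = mod-cong m (begin
  (r + toℕ ((s + toℕ i) mod m)) % m   ≡⟨ cong (λ x → (r + x) % m) (toℕ-mod (s + toℕ i) m) ⟩
  (r + (s + toℕ i) % m) % m           ≡⟨ ≈-+ {a = r} refl (%-≈ (s + toℕ i)) ⟩
  (r + (s + toℕ i)) % m               ≡⟨ cong (_% m) (+-assoc r s (toℕ i)) ⟨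
  (r + s + toℕ i) % m                 ∎)
  where open ≡-Reasoning

shift-period : ∀ {m} .{{_ : NonZero m}} (i : Fin m) → shift m i ≡ i
shift-period {m} i = trans (mod-cong m (trans (cong (_% m) (+-comm m (toℕ i))) (≈-+g (toℕ i)))) (toℕ-mod-id i)

unshift : ∀ {m} .{{_ : NonZero m}} (r : Fin m) (i : Fin m) → shift (toℕ r) (shift (m ∸ toℕ r) i) ≡ i
unshift {m} r i = trans (shift-+ (toℕ r) (m ∸ toℕ r) i)
  (trans (cong (λ x → shift x i) (m+[n∸m]≡n (<⇒≤ (toℕ<n r)))) (shift-period i))

shift-injective : ∀ {m} .{{_ : NonZero m}} r {i j : Fin m} → shift r i ≡ shift r j → i ≡ j
shift-injective {m} r {i} {j} p = toℕ-injective (≈-small (toℕ<n i) (toℕ<n j) (≈-cancelˡ r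
  (trans (sym (toℕ-mod (r + toℕ i) m)) (trans (cong toℕ p) (toℕ-mod (r + toℕ j) m)))))

rotate-≋ : ∀ {V : Set} {m} .{{_ : NonZero m}} (f : Fin m → V) (r : Fin m) → (f ∘ shift (toℕ r)) ≋ f
rotate-≋ {m = m} f r =
  ⊑-along (shift (toℕ r)) (shift-consecutive (toℕ r)) (λ _ → refl) ,
  ⊑-along (shift (m ∸ toℕ r)) (shift-consecutive (m ∸ toℕ r)) (λ i → cong f (sym (unshift r i)))

opposite-consecutive : ∀ {m} {i j : Fin m} → Consecutive m i j → Consecutive m (opposite j) (opposite i)
opposite-consecutive {m} {i} {j} (inj₁ p) = inj₁ (begin
  suc (toℕ (opposite j))     ≡⟨ cong suc (opposite-prop j) ⟩
  suc (m ∸ suc (toℕ j))      ≡⟨ +-∸-assoc 1 (toℕ<n j) ⟨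
  m ∸ toℕ j                  ≡⟨ cong (m ∸_) p ⟨
  m ∸ suc (toℕ i)            ≡⟨ opposite-prop i ⟨
  toℕ (opposite i)           ∎)
  where open ≡-Reasoning
opposite-consecutive {m} {i} {j} (inj₂ (p , q)) = inj₂
  ( (begin
      suc (toℕ (opposite j))     ≡⟨ cong suc (opposite-prop j) ⟩
      suc (m ∸ suc (toℕ j))      ≡⟨ +-∸-assoc 1 (toℕ<n j) ⟨
      m ∸ toℕ j                  ≡⟨ cong (m ∸_) q ⟩
      m                          ∎)
  , trans (opposite-prop i) (trans (cong (m ∸_) p) (n∸n≡0 m)))
  where open ≡-Reasoning

reverse-≋ : ∀ {V : Set} {m} (f : Fin m → V) → (f ∘ opposite) ≋ f
reverse-≋ f =
  ⊑-reversing opposite opposite-consecutive (λ _ → refl) ,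
  ⊑-reversing opposite opposite-consecutive (λ i → cong f (sym (opposite-involutive i)))

-- Graphs with numbered neighbours and a system of girth cycles

module _ {V : Set} {k : ℕ} (nb : V → Fin k → V) where

  Adjacent : V → V → Set
  Adjacent a b = ∃ λ p → nb a p ≡ b

  Cycle : (m : ℕ) → (Fin m → V) → Set
  Cycle m f = (∀ i j → f i ≡ f j → i ≡ j) × (∀ i j → Consecutive m i j → Adjacent (f i) (f j))

-- Cells are the girth cycles through a vertex, as parametrised cycles. Numbered neighbours turn
-- regularity into injectivity, and a free choice of `Vertex` lets products and covers keep their
-- natural vertex types. The case `l = 0` is allowed and says that there are no `g`-cycles.
record CellSystem (k g l : ℕ) : Set₁ where
  field
    {Vertex} : Set
    {size}   : ℕ
    index    : Vertex ↔ Fin size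
    origin   : Vertex
    nb             : Vertex → Fin k → Vertex
    nb-injective   : ∀ a {p q} → nb a p ≡ nb a q → p ≡ q
    nb-symmetric   : ∀ a p → Adjacent nb (nb a p) a
    nb-irreflexive : ∀ a p → nb a p ≢ a
    cell           : Vertex → Fin l → Fin g → Vertex
    cell-cycle     : ∀ a c → Cycle nb g (cell a c)
    cell-through   : ∀ a c → ∃ λ i → cell a c i ≡ a
    cell-separated : ∀ a c c′ → cell a c ⊑ cell a c′ → c ≡ c′
    no-short-cycle : ∀ m f → 3 ≤ m → m < g → ¬ Cycle nb m f
    cell-complete  : ∀ f → Cycle nb g f → ∀ i → ∃ λ c → cell (f i) c ≋ f

cycle-shift : ∀ {V : Set} {k} (nb : V → Fin k → V) {m} .{{_ : NonZero m}} {f : Fin m → V} r →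
  Cycle nb m f → Cycle nb m (f ∘ shift r)
cycle-shift nb r (inj , adj) =
  (λ i j p → shift-injective r (inj _ _ p)) , (λ i j c → adj _ _ (shift-consecutive r c))

-- From cell systems to graphs on `Fin size`

enum : ∀ {n} (S : Subset n) → Fin ∣ S ∣ → Fin n
enum (outside ∷ S) i = suc (enum S i)
enum (inside ∷ S) zero = zero
enum (inside ∷ S) (suc i) = suc (enum S i)

enum-injective : ∀ {n} (S : Subset n) {i j} → enum S i ≡ enum S j → i ≡ j
enum-injective (outside ∷ S) p = enum-injective S (Fin.suc-injective p)
enum-injective (inside ∷ S) {zero} {zero} p = refl
enum-injective (inside ∷ S) {suc i} {suc j} p = cong suc (enum-injective S (Fin.suc-injective p))

enum-∈ : ∀ {n} (S : Subset n) i → enum S i ∈ₛ S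
enum-∈ (outside ∷ S) i = there (enum-∈ S i)
enum-∈ (inside ∷ S) zero = here
enum-∈ (inside ∷ S) (suc i) = there (enum-∈ S i)

enum-surjective : ∀ {n} (S : Subset n) {x} → x ∈ₛ S → ∃ λ i → enum S i ≡ x
enum-surjective (inside ∷ S) here = zero , refl
enum-surjective (outside ∷ S) (there x∈S) with i , p ← enum-surjective S x∈S = i , cong suc p
enum-surjective (inside ∷ S) (there x∈S) with i , p ← enum-surjective S x∈S = suc i , cong suc p

∣∣-of-image : ∀ {n k} (S : Subset n) (f : Fin k → Fin n) → (∀ {p q} → f p ≡ f q → p ≡ q) →
  (∀ p → f p ∈ₛ S) → (∀ {x} → x ∈ₛ S → ∃ λ p → f p ≡ x) → ∣ S ∣ ≡ k
∣∣-of-image S f inj f∈S onto = ≤-antisym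
  (injective⇒≤ {f = λ i → proj₁ (onto (enum-∈ S i))} λ {i} {j} p → enum-injective S
    (trans (sym (proj₂ (onto (enum-∈ S i)))) (trans (cong f p) (proj₂ (onto (enum-∈ S j))))))
  (injective⇒≤ {f = λ p → proj₁ (enum-surjective S (f∈S p))} λ {p} {q} e → inj
    (trans (sym (proj₂ (enum-surjective S (f∈S p)))) (trans (cong (enum S) e) (proj₂ (enum-surjective S (f∈S q))))))

module _ {v : ℕ} {R : Fin v → Fin v → Set} (R? : ∀ a b → Dec (R a b)) where

  fromDec : EdgeSet v
  fromDec = tabulate λ a → tabulate λ b → does (R? a b)

  lookup-fromDec : ∀ a b → lookup (lookup fromDec a) b ≡ does (R? a b)
  lookup-fromDec a b = trans (cong (λ S → lookup S b) (lookup∘tabulate _ a)) (lookup∘tabulate _ b)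

  fromDec⁺ : ∀ {a b} → R a b → a ~[ fromDec ] b
  fromDec⁺ {a} {b} r = lookup⇒[]= b _ (trans (lookup-fromDec a b) (dec-true (R? a b) r))

  fromDec⁻ : ∀ {a b} → a ~[ fromDec ] b → R a b
  fromDec⁻ {a} {b} r with R? a b | trans (sym (lookup-fromDec a b)) ([]=⇒lookup r)
  ... | yes p | _ = p
  ... | no _  | ()

edgeSet-ext : ∀ {v} {C D : EdgeSet v} → (∀ a b → a ~[ C ] b → a ~[ D ] b) → (∀ a b → a ~[ D ] b → a ~[ C ] b) → C ≡ D
edgeSet-ext {C = C} {D} C⊆D D⊆C = begin
  C                    ≡⟨ tabulate∘lookup C ⟨
  tabulate (lookup C)  ≡⟨ tabulate-cong (λ a → ⊆-antisym (λ {b} → C⊆D a b) (λ {b} → D⊆C a b)) ⟩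
  tabulate (lookup D)  ≡⟨ tabulate∘lookup D ⟩
  D                    ∎
  where open ≡-Reasoning

edgeOf? : ∀ {v m} (f : Fin m → Fin v) a b → Dec (EdgeOf f a b)
edgeOf? {m = m} f a b = any? λ i → any? λ j →
  ((suc (toℕ i) ≟ toℕ j) ⊎-dec ((suc (toℕ i) ≟ m) ×-dec (toℕ j ≟ 0))) ×-dec
  (((f i Fin.≟ a) ×-dec (f j Fin.≟ b)) ⊎-dec ((f i Fin.≟ b) ×-dec (f j Fin.≟ a)))

map-edgeOf : ∀ {V W : Set} {m} (φ : V → W) {f : Fin m → V} {a b} → EdgeOf f a b → EdgeOf (φ ∘ f) (φ a) (φ b)
map-edgeOf φ (i , j , c , inj₁ (p , q)) = i , j , c , inj₁ (cong φ p , cong φ q)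
map-edgeOf φ (i , j , c , inj₂ (p , q)) = i , j , c , inj₂ (cong φ p , cong φ q)

map-⊑ : ∀ {V W : Set} {m n} (φ : V → W) {f : Fin m → V} {f′ : Fin n → V} → f ⊑ f′ → (φ ∘ f) ⊑ (φ ∘ f′)
map-⊑ φ {f} {f′} sub a b (i , j , c , inj₁ (refl , refl)) = map-edgeOf φ (sub (f i) (f j) (i , j , c , inj₁ (refl , refl)))
map-⊑ φ {f} {f′} sub a b (i , j , c , inj₂ (refl , refl)) = map-edgeOf φ (sub (f j) (f i) (i , j , c , inj₂ (refl , refl)))

map-≋ : ∀ {V W : Set} {m n} (φ : V → W) {f : Fin m → V} {f′ : Fin n → V} → f ≋ f′ → (φ ∘ f) ≋ (φ ∘ f′)
map-≋ φ {f} {f′} (p , q) = map-⊑ φ p , map-⊑ φ q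

edgeOf-next : ∀ {V : Set} {m} .{{_ : NonZero m}} (f : Fin m → V) i → EdgeOf f (f i) (f (suc (toℕ i) mod m))
edgeOf-next {m = m} f i = i , suc (toℕ i) mod m ,
  subst (λ j → Consecutive m j (suc (toℕ i) mod m)) (toℕ-mod-id i) (mod-consecutive (toℕ i) m) , inj₁ (refl , refl)

onCycle⁻ : ∀ {V : Set} {m} {f : Fin m → V} {a b} → EdgeOf f a b → ∃ λ i → f i ≡ a
onCycle⁻ (i , j , c , inj₁ (p , q)) = i , p
onCycle⁻ (i , j , c , inj₂ (p , q)) = j , q

module _ {k g l : ℕ} (𝒞 : CellSystem k g l) (3≤g : 3 ≤ g) where

  open CellSystem 𝒞

  private
    instance
      g≢0 : NonZero g
      g≢0 = >-nonZero (≤-trans (s≤s z≤n) 3≤g)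

    enc : Vertex → Fin size
    enc = Inverse.to index

    dec : Fin size → Vertex
    dec = Inverse.from index

    enc-dec : ∀ a → enc (dec a) ≡ a
    enc-dec a = Inverse.inverseˡ index refl

    dec-enc : ∀ x → dec (enc x) ≡ x
    dec-enc x = Inverse.inverseʳ index refl

    enc-injective : ∀ {x y} → enc x ≡ enc y → x ≡ y
    enc-injective {x} {y} p = trans (sym (dec-enc x)) (trans (cong dec p) (dec-enc y))

    Adj? : ∀ a b → Dec (∃ λ p → enc (nb (dec a) p) ≡ b)
    Adj? a b = any? λ p → enc (nb (dec a) p) Fin.≟ b

    adj⇒ : ∀ {a b} → (∃ λ p → enc (nb (dec a) p) ≡ b) → Adjacent nb (dec a) (dec b)
    adj⇒ (p , e) = p , trans (sym (dec-enc _)) (cong dec e)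

    adj⇐ : ∀ {x y} → Adjacent nb x y → ∃ λ p → enc (nb (dec (enc x)) p) ≡ enc y
    adj⇐ {x} (p , refl) = p , cong (λ z → enc (nb z p)) (dec-enc x)

  cellGraph : Graph size
  edges cellGraph = fromDec Adj?
  symmetric cellGraph a b e with p , refl ← fromDec⁻ Adj? e with q , r ← nb-symmetric (dec a) p =
    fromDec⁺ Adj? (q , trans (cong (λ z → enc (nb z q)) (dec-enc _)) (trans (cong enc r) (enc-dec a)))
  loopless cellGraph a e with p , r ← fromDec⁻ Adj? e =
    nb-irreflexive (dec a) p (trans (sym (dec-enc _)) (cong dec r))

  private
    cyc : ∀ {m} → (Fin m → Vertex) → EdgeSet size
    cyc f = fromDec (edgeOf? (enc ∘ f))

    cyc-isCycle : ∀ {m f} → 3 ≤ m → Cycle nb m f → IsCycle cellGraph m (cyc f)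
    cyc-isCycle {m} {f} 3≤m (inj , adj) = 3≤m , sub , enc ∘ f , (λ i j p → inj i j (enc-injective p)) ,
      λ a b → mk⇔ (fromDec⁻ (edgeOf? (enc ∘ f))) (fromDec⁺ (edgeOf? (enc ∘ f)))
      where
      sub : ∀ a b → a ~[ cyc f ] b → a ~[ edges cellGraph ] b
      sub a b e with fromDec⁻ (edgeOf? (enc ∘ f)) e
      ... | i , j , c , inj₁ (refl , refl) = fromDec⁺ Adj? (adj⇐ (adj i j c))
      ... | i , j , c , inj₂ (refl , refl) = symmetric cellGraph _ _ (fromDec⁺ Adj? (adj⇐ (adj i j c)))

    isCycle⁻ : ∀ {m} C → IsCycle cellGraph m C →
      Σ (Fin m → Vertex) λ f → Cycle nb m f ×
        (∀ a b → a ~[ C ] b → EdgeOf (enc ∘ f) a b) × (∀ a b → EdgeOf (enc ∘ f) a b → a ~[ C ] b)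
    isCycle⁻ {m} C (_ , sub , f , inj , char) =
      dec ∘ f ,
      ((λ i j p → inj i j (trans (sym (enc-dec (f i))) (trans (cong enc p) (enc-dec (f j))))) ,
       (λ i j c → adj⇒ (fromDec⁻ Adj? (sub _ _ (Equivalence.from (char (f i) (f j)) (i , j , c , inj₁ (refl , refl))))))) ,
      (λ a b e → proj₂ same a b (Equivalence.to (char a b) e)) ,
      (λ a b e → Equivalence.from (char a b) (proj₁ same a b e))
      where
      same : (enc ∘ dec ∘ f) ≋ f
      same = ≗⇒≋ (enc-dec ∘ f)

    cyc-≡ : ∀ {m n} {f : Fin m → Vertex} {f′ : Fin n → Vertex} → f ≋ f′ → cyc f ≡ cyc f′
    cyc-≡ {f = f} {f′} f≋f′ with p , q ← map-≋ enc f≋f′ = edgeSet-ext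
      (λ a b e → fromDec⁺ (edgeOf? (enc ∘ f′)) (p a b (fromDec⁻ (edgeOf? (enc ∘ f)) e)))
      (λ a b e → fromDec⁺ (edgeOf? (enc ∘ f)) (q a b (fromDec⁻ (edgeOf? (enc ∘ f′)) e)))

    cyc-⊑ : ∀ {m n} {f : Fin m → Vertex} {f′ : Fin n → Vertex} → cyc f ≡ cyc f′ → f ⊑ f′
    cyc-⊑ {f = f} {f′} p a b e = unmap (fromDec⁻ (edgeOf? (enc ∘ f′))
      (subst (λ C → enc a ~[ C ] enc b) p (fromDec⁺ (edgeOf? (enc ∘ f)) (map-edgeOf enc e))))
      where
      unmap : ∀ {a b} → EdgeOf (enc ∘ f′) (enc a) (enc b) → EdgeOf f′ a b
      unmap (i , j , c , inj₁ (r , s)) = i , j , c , inj₁ (enc-injective r , enc-injective s)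
      unmap (i , j , c , inj₂ (r , s)) = i , j , c , inj₂ (enc-injective r , enc-injective s)

  -- The argument `c₀` supplies the cycle that shows the girth to be attained.
  cellGraph-isVGR : Fin l → IsVGR size k g l cellGraph
  cellGraph-isVGR c₀ = regular , (girthCycle , noShort) , onCells
    where
    regular : Regular k cellGraph
    regular a = ∣∣-of-image _ (λ p → enc (nb (dec a) p)) (λ e → nb-injective (dec a) (enc-injective e))
      (λ p → fromDec⁺ Adj? (p , refl)) (fromDec⁻ Adj?)

    girthCycle : ∃ λ C → IsCycle cellGraph g C
    girthCycle = cyc (cell origin c₀) , cyc-isCycle 3≤g (cell-cycle origin c₀)

    noShort : ∀ m C → m < g → ¬ IsCycle cellGraph m C
    noShort m C m<g isC with f , cy , _ ← isCycle⁻ C isC = no-short-cycle m f (proj₁ isC) m<g cy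

    onCells : ∀ a → ExactlyOnCycles l g cellGraph a
    onCells a = (λ c → cyc (cell (dec a) c)) ,
      (λ c → cyc-isCycle 3≤g (cell-cycle (dec a) c) , through c) ,
      (λ c c′ p → cell-separated (dec a) c c′ (cyc-⊑ p)) ,
      complete
      where
      through : ∀ c → OnCycle a (cyc (cell (dec a) c))
      through c with i , p ← cell-through (dec a) c =
        enc (cell (dec a) c (suc (toℕ i) mod g)) ,
        fromDec⁺ (edgeOf? (enc ∘ cell (dec a) c))
          (subst (λ x → EdgeOf (enc ∘ cell (dec a) c) x (enc (cell (dec a) c (suc (toℕ i) mod g))))
            (trans (cong enc p) (enc-dec a)) (edgeOf-next (enc ∘ cell (dec a) c) i))

      complete : ∀ C → IsCycle cellGraph g C → OnCycle a C → ∃ λ c → cyc (cell (dec a) c) ≡ C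
      complete C isC (b , ab) with isCycle⁻ C isC
      ... | f , cy , to , from with onCycle⁻ (to a b ab)
      ... | i , refl with cell-complete f cy i
      ... | c , same = c , trans (cyc-≡ (subst (λ x → cell x c ≋ f) (sym (dec-enc (f i))) same))
        (edgeSet-ext (λ x y e → from x y (fromDec⁻ (edgeOf? (enc ∘ f)) e)) (λ x y e → fromDec⁺ (edgeOf? (enc ∘ f)) (to x y e)))

-- Disjoint copies

-- Used to keep a cycle of a disjoint union inside one copy.
cyclic-constant : ∀ {W : Set} {m} (w : Fin m → W) → (∀ i j → Consecutive m i j → w i ≡ w j) → ∀ i j → w i ≡ w j
cyclic-constant {m = suc m} w step i j = trans (from0 i) (sym (from0 j))
  where
  go : ∀ n → w (n mod suc m) ≡ w zero
  go zero = cong w (toℕ-mod-id zero)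
  go (suc n) = trans (sym (step _ _ (mod-consecutive n (suc m)))) (go n)
  from0 : ∀ i → w i ≡ w zero
  from0 i = trans (cong w (sym (toℕ-mod-id i))) (go (toℕ i))

copies : ∀ {k g l} n → CellSystem k g l → CellSystem k g l
copies {k} {g} {l} n 𝒞 = record
  { index = ↔-sym *↔× ↔-∘ (index ×-↔ ↔-id (Fin (suc n)))
  ; origin = origin , zero
  ; nb = λ (a , x) p → nb a p , x
  ; nb-injective = λ (a , x) e → nb-injective a (cong proj₁ e)
  ; nb-symmetric = λ (a , x) p → proj₁ (nb-symmetric a p) , cong (_, x) (proj₂ (nb-symmetric a p))
  ; nb-irreflexive = λ (a , x) p e → nb-irreflexive a p (cong proj₁ e)
  ; cell = λ (a , x) c i → cell a c i , x
  ; cell-cycle = λ (a , x) c →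
      (λ i j e → proj₁ (cell-cycle a c) i j (cong proj₁ e)) ,
      (λ i j cn → proj₁ (proj₂ (cell-cycle a c) i j cn) , cong (_, x) (proj₂ (proj₂ (cell-cycle a c) i j cn)))
  ; cell-through = λ (a , x) c → proj₁ (cell-through a c) , cong (_, x) (proj₂ (cell-through a c))
  ; cell-separated = λ (a , x) c c′ sub → cell-separated a c c′ (map-⊑ proj₁ sub)
  ; no-short-cycle = λ m f 3≤m m<g cy → no-short-cycle m (proj₁ ∘ f) 3≤m m<g (proj-cycle cy)
  ; cell-complete = λ f cy i → proj₁ (cell-complete (proj₁ ∘ f) (proj-cycle cy) i) ,
      ≋-trans (map-≋ (_, proj₂ (f i)) (proj₂ (cell-complete (proj₁ ∘ f) (proj-cycle cy) i)))
        (≗⇒≋ λ j → cong (proj₁ (f j) ,_) (level cy i j))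
  }
  where
  open CellSystem 𝒞
  nb′ : Vertex × Fin (suc n) → Fin k → Vertex × Fin (suc n)
  nb′ (a , x) p = nb a p , x
  level : ∀ {m f} → Cycle nb′ m f → ∀ i j → proj₂ (f i) ≡ proj₂ (f j)
  level {f = f} (_ , adj) = cyclic-constant (proj₂ ∘ f) λ i j c → cong proj₂ (proj₂ (adj i j c))
  proj-cycle : ∀ {m f} → Cycle nb′ m f → Cycle nb m (proj₁ ∘ f)
  proj-cycle cy@(inj , adj) =
    (λ i j e → inj i j (cong₂ _,_ e (level cy i j))) ,
    (λ i j c → proj₁ (adj i j c) , cong proj₁ (proj₂ (adj i j c)))

nonempty-≤ : ∀ {v n} → Fin v → n ≤ v * n
nonempty-≤ {suc v} {n} _ = m≤m+n n (v * n)

cellSystem⇒infinitelyMany : ∀ {k g l} → 3 ≤ g → 0 < l → CellSystem k g l → InfinitelyManyVGR k g l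
cellSystem⇒infinitelyMany {l = suc l} 3≤g _ 𝒞 n =
  -- The graph `𝒟` consists of `suc n` copies of a nonempty graph, hence has more than `n` vertices.
  size 𝒟 , ≤-trans (n≤1+n n) (nonempty-≤ (Inverse.to (index 𝒞) (origin 𝒞))) ,
  cellGraph 𝒟 3≤g , cellGraph-isVGR 𝒟 3≤g zero
  where
  open CellSystem
  𝒟 = copies n 𝒞

-- Triangles in Cartesian products

splitAt-injective : ∀ m {n} {i j : Fin (m + n)} → splitAt m i ≡ splitAt m j → i ≡ j
splitAt-injective m {n} {i} {j} e = trans (sym (join-splitAt m n i)) (trans (cong (join m n) e) (join-splitAt m n j))

module CartesianProduct {k k′ l l′ : ℕ} (𝒞 : CellSystem k 3 l) (𝒟 : CellSystem k′ 3 l′) where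

  private
    module C = CellSystem 𝒞
    module D = CellSystem 𝒟

  Pair : Set
  Pair = C.Vertex × D.Vertex

  nbₛ : Pair → Fin k ⊎ Fin k′ → Pair
  nbₛ (a , b) (inj₁ p) = C.nb a p , b
  nbₛ (a , b) (inj₂ q) = a , D.nb b q

  nb : Pair → Fin (k + k′) → Pair
  nb x p = nbₛ x (splitAt k p)

  cellₛ : Pair → Fin l ⊎ Fin l′ → Fin 3 → Pair
  cellₛ (a , b) (inj₁ c) i = C.cell a c i , b
  cellₛ (a , b) (inj₂ c) i = a , D.cell b c i

  adjˡ : ∀ {a a′} b → Adjacent C.nb a a′ → Adjacent nb (a , b) (a′ , b)
  adjˡ {a} b (p , e) = p ↑ˡ k′ , trans (cong (nbₛ (a , b)) (splitAt-↑ˡ k p k′)) (cong (_, b) e)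

  adjʳ : ∀ a {b b′} → Adjacent D.nb b b′ → Adjacent nb (a , b) (a , b′)
  adjʳ a {b} (p , e) = k ↑ʳ p , trans (cong (nbₛ (a , b)) (splitAt-↑ʳ k k′ p)) (cong (a ,_) e)

  adj⁻ : ∀ {a b a′ b′} → Adjacent nb (a , b) (a′ , b′) →
    (Adjacent C.nb a a′ × b ≡ b′) ⊎ (a ≡ a′ × Adjacent D.nb b b′)
  adj⁻ (p , e) with splitAt k p
  adj⁻ (p , refl) | inj₁ q = inj₁ ((q , refl) , refl)
  adj⁻ (p , refl) | inj₂ q = inj₂ (refl , (q , refl))

  nbₛ-injective : ∀ x {s s′} → nbₛ x s ≡ nbₛ x s′ → s ≡ s′
  nbₛ-injective (a , b) {inj₁ p} {inj₁ q} e = cong inj₁ (C.nb-injective a (cong proj₁ e))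
  nbₛ-injective (a , b) {inj₁ p} {inj₂ q} e = contradiction (cong proj₁ e) (C.nb-irreflexive a p)
  nbₛ-injective (a , b) {inj₂ p} {inj₁ q} e = contradiction (sym (cong proj₁ e)) (C.nb-irreflexive a q)
  nbₛ-injective (a , b) {inj₂ p} {inj₂ q} e = cong inj₂ (D.nb-injective b (cong proj₂ e))

  nbₛ-symmetric : ∀ x s → Adjacent nb (nbₛ x s) x
  nbₛ-symmetric (a , b) (inj₁ p) = adjˡ b (C.nb-symmetric a p)
  nbₛ-symmetric (a , b) (inj₂ q) = adjʳ a (D.nb-symmetric b q)

  nbₛ-irreflexive : ∀ x s → nbₛ x s ≢ x
  nbₛ-irreflexive (a , b) (inj₁ p) e = C.nb-irreflexive a p (cong proj₁ e)
  nbₛ-irreflexive (a , b) (inj₂ q) e = D.nb-irreflexive b q (cong proj₂ e)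

  cellₛ-cycle : ∀ x s → Cycle nb 3 (cellₛ x s)
  cellₛ-cycle (a , b) (inj₁ c) with inj , adj ← C.cell-cycle a c =
    (λ i j e → inj i j (cong proj₁ e)) , (λ i j cn → adjˡ b (adj i j cn))
  cellₛ-cycle (a , b) (inj₂ c) with inj , adj ← D.cell-cycle b c =
    (λ i j e → inj i j (cong proj₂ e)) , (λ i j cn → adjʳ a (adj i j cn))

  cellₛ-through : ∀ x s → ∃ λ i → cellₛ x s i ≡ x
  cellₛ-through (a , b) (inj₁ c) with i , e ← C.cell-through a c = i , cong (_, b) e
  cellₛ-through (a , b) (inj₂ c) with i , e ← D.cell-through b c = i , cong (a ,_) e

  firstEdge : ∀ {V : Set} (f : Fin 3 → V) → EdgeOf f (f zero) (f (suc zero))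
  firstEdge f = zero , suc zero , inj₁ refl , inj₁ (refl , refl)

  first≢second : ∀ {A : Set} → _≡_ {A = Fin 3} zero (suc zero) → A
  first≢second ()

  -- Cells in different directions share no edge: the edges of each are constant in the coordinate
  -- in which the edges of the other move.
  cellₛ-separated : ∀ x s s′ → cellₛ x s ⊑ cellₛ x s′ → s ≡ s′
  cellₛ-separated (a , b) (inj₁ c) (inj₁ c′) sub = cong inj₁ (C.cell-separated a c c′ (map-⊑ proj₁ sub))
  cellₛ-separated (a , b) (inj₂ c) (inj₂ c′) sub = cong inj₂ (D.cell-separated b c c′ (map-⊑ proj₂ sub))
  cellₛ-separated (a , b) (inj₁ c) (inj₂ c′) sub with sub _ _ (firstEdge _)
  ... | _ , _ , _ , inj₁ (p , q) = first≢second (proj₁ (C.cell-cycle a c) zero (suc zero) (trans (sym (cong proj₁ p)) (cong proj₁ q)))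
  ... | _ , _ , _ , inj₂ (p , q) = first≢second (proj₁ (C.cell-cycle a c) zero (suc zero) (trans (sym (cong proj₁ q)) (cong proj₁ p)))
  cellₛ-separated (a , b) (inj₂ c) (inj₁ c′) sub with sub _ _ (firstEdge _)
  ... | _ , _ , _ , inj₁ (p , q) = first≢second (proj₁ (D.cell-cycle b c) zero (suc zero) (trans (sym (cong proj₂ p)) (cong proj₂ q)))
  ... | _ , _ , _ , inj₂ (p , q) = first≢second (proj₁ (D.cell-cycle b c) zero (suc zero) (trans (sym (cong proj₂ q)) (cong proj₂ p)))

  irreflˡ : ∀ {a a′} {X : Set} → Adjacent C.nb a a′ → a ≡ a′ → X
  irreflˡ (p , refl) e = ⊥-elim (C.nb-irreflexive _ p (sym e))

  irreflʳ : ∀ {b b′} {X : Set} → Adjacent D.nb b b′ → b ≡ b′ → X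
  irreflʳ (p , refl) e = ⊥-elim (D.nb-irreflexive _ p (sym e))

  -- A triangle cannot have exactly one step in one of the two directions.
  triangle : ∀ f → Cycle nb 3 f →
    (Cycle C.nb 3 (proj₁ ∘ f) × (∀ i j → proj₂ (f i) ≡ proj₂ (f j))) ⊎
    (Cycle D.nb 3 (proj₂ ∘ f) × (∀ i j → proj₁ (f i) ≡ proj₁ (f j)))
  triangle f (inj , adj)
    with adj⁻ (adj zero (suc zero) (inj₁ refl)) | adj⁻ (adj (suc zero) (suc (suc zero)) (inj₁ refl)) | adj⁻ (adj (suc (suc zero)) zero (inj₂ (refl , refl)))
  ... | inj₁ (p , e) | inj₁ (q , e′) | inj₁ (r , e″) = inj₁
    ( ((λ i j eq → inj i j (cong₂ _,_ eq (const i j))) , λ i j cn → [ proj₁ , (λ (_ , z) → irreflʳ z (const i j)) ]′ (adj⁻ (adj i j cn)))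
    , const)
    where
    step : ∀ i → proj₂ (f i) ≡ proj₂ (f zero)
    step zero = refl
    step (suc zero) = sym e
    step (suc (suc zero)) = e″
    const : ∀ i j → proj₂ (f i) ≡ proj₂ (f j)
    const i j = trans (step i) (sym (step j))
  ... | inj₂ (e , p) | inj₂ (e′ , q) | inj₂ (e″ , r) = inj₂
    ( ((λ i j eq → inj i j (cong₂ _,_ (const i j) eq)) , λ i j cn → [ (λ (z , _) → irreflˡ z (const i j)) , proj₂ ]′ (adj⁻ (adj i j cn)))
    , const)
    where
    step : ∀ i → proj₁ (f i) ≡ proj₁ (f zero)
    step zero = refl
    step (suc zero) = sym e
    step (suc (suc zero)) = e″
    const : ∀ i j → proj₁ (f i) ≡ proj₁ (f j)
    const i j = trans (step i) (sym (step j))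
  ... | inj₂ (_ , p) | inj₁ (_ , e′) | inj₁ (_ , e″) = irreflʳ p (sym (trans e′ e″))
  ... | inj₁ (_ , e) | inj₂ (_ , q) | inj₁ (_ , e″) = irreflʳ q (sym (trans e″ e))
  ... | inj₁ (_ , e) | inj₁ (_ , e′) | inj₂ (_ , r) = irreflʳ r (sym (trans e e′))
  ... | inj₁ (p , _) | inj₂ (e′ , _) | inj₂ (e″ , _) = irreflˡ p (sym (trans e′ e″))
  ... | inj₂ (e , _) | inj₁ (q , _) | inj₂ (e″ , _) = irreflˡ q (sym (trans e″ e))
  ... | inj₂ (e , _) | inj₂ (e′ , _) | inj₁ (r , _) = irreflˡ r (sym (trans e e′))

  cellₛ-complete : ∀ f → Cycle nb 3 f → ∀ i → ∃ λ s → cellₛ (f i) s ≋ f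
  cellₛ-complete f cy i with triangle f cy
  ... | inj₁ (cyˡ , const) with c , same ← C.cell-complete (proj₁ ∘ f) cyˡ i =
    inj₁ c , ≋-trans (map-≋ (_, proj₂ (f i)) same) (≗⇒≋ λ j → cong (proj₁ (f j) ,_) (const i j))
  ... | inj₂ (cyʳ , const) with c , same ← D.cell-complete (proj₂ ∘ f) cyʳ i =
    inj₂ c , ≋-trans (map-≋ (proj₁ (f i) ,_) same) (≗⇒≋ λ j → cong (_, proj₂ (f j)) (const i j))

  product : CellSystem (k + k′) 3 (l + l′)
  product = record
    { index = ↔-sym *↔× ↔-∘ (C.index ×-↔ D.index)
    ; origin = C.origin , D.origin
    ; nb = nb
    ; nb-injective = λ x e → splitAt-injective k (nbₛ-injective x e)
    ; nb-symmetric = λ x p → nbₛ-symmetric x (splitAt k p)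
    ; nb-irreflexive = λ x p → nbₛ-irreflexive x (splitAt k p)
    ; cell = λ x c → cellₛ x (splitAt l c)
    ; cell-cycle = λ x c → cellₛ-cycle x (splitAt l c)
    ; cell-through = λ x c → cellₛ-through x (splitAt l c)
    ; cell-separated = λ x c c′ sub → splitAt-injective l (cellₛ-separated x (splitAt l c) (splitAt l c′) sub)
    ; no-short-cycle = λ m f 3≤m m<3 _ → <⇒≱ m<3 3≤m
    ; cell-complete = λ f cy i → complete (cellₛ-complete f cy i)
    }
    where
    complete : ∀ {f : Fin 3 → Pair} {i} → (∃ λ s → cellₛ (f i) s ≋ f) → ∃ λ c → cellₛ (f i) (splitAt l c) ≋ f
    complete {f} {i} (s , same) = join l l′ s , subst (λ s → cellₛ (f i) s ≋ f) (sym (splitAt-join l l′ s)) same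

-- Graphs verified by exhaustive search

trace : ∀ {V : Set} → (ℕ → V) → ℕ → List V
trace F zero = F zero ∷ []
trace F (suc n) = F (suc n) ∷ trace F n

trace-injective : ∀ {V : Set} {F F′ : ℕ → V} n → trace F n ≡ trace F′ n → ∀ i → i ≤ n → F i ≡ F′ i
trace-injective zero e zero z≤n = proj₁ (∷-injective e)
trace-injective (suc n) e i i≤n with m≤n⇒m<n∨m≡n i≤n
... | inj₁ (s≤s i≤n′) = trace-injective n (proj₂ (∷-injective e)) i i≤n′
... | inj₂ refl = proj₁ (∷-injective e)

length-trace : ∀ {V : Set} (F : ℕ → V) n → length (trace F n) ≡ suc n
length-trace F zero = refl
length-trace F (suc n) = cong suc (length-trace F n)

-- Negation modulo `m`. Unlike `opposite` it fixes the index 0, so a cell and its reversal both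
-- start at the vertex from which the search starts.
backward : ∀ {m} .{{_ : NonZero m}} → Fin m → Fin m
backward {m} i = (m ∸ toℕ i) mod m

backward-≈ : ∀ {m} .{{_ : NonZero m}} (i : Fin m) → toℕ (backward i) + toℕ i ≈[ m ] 0
backward-≈ {m} i = begin
  (toℕ (backward i) + toℕ i) % m    ≡⟨ cong (λ x → (x + toℕ i) % m) (toℕ-mod (m ∸ toℕ i) m) ⟩
  ((m ∸ toℕ i) % m + toℕ i) % m     ≡⟨ ≈-+ {c = toℕ i} (%-≈ (m ∸ toℕ i)) refl ⟩
  (m ∸ toℕ i + toℕ i) % m           ≡⟨ cong (_% m) (m∸n+n≡m (<⇒≤ (toℕ<n i))) ⟩
  m % m                             ≡⟨ ≈-+g 0 ⟩
  0 % m                             ∎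
  where open ≡-Reasoning

backward-consecutive : ∀ {m} .{{_ : NonZero m}} {i j : Fin m} → Consecutive m i j → Consecutive m (backward j) (backward i)
backward-consecutive {m} {i} {j} c = ≈⇒consecutive (≈-cancelʳ (toℕ i) (begin
  (suc (toℕ (backward j)) + toℕ i) % m   ≡⟨ cong (_% m) (+-suc (toℕ (backward j)) (toℕ i)) ⟨
  (toℕ (backward j) + suc (toℕ i)) % m   ≡⟨ ≈-+ {a = toℕ (backward j)} refl (consecutive⇒≈ c) ⟩
  (toℕ (backward j) + toℕ j) % m         ≡⟨ backward-≈ j ⟩
  0 % m                                  ≡⟨ backward-≈ i ⟨
  (toℕ (backward i) + toℕ i) % m         ∎))
  where open ≡-Reasoning

backward-involutive : ∀ {m} .{{_ : NonZero m}} (i : Fin m) → backward (backward i) ≡ i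
backward-involutive {m} i = toℕ-injective (≈-small (toℕ<n _) (toℕ<n i) (≈-cancelʳ (toℕ (backward i)) (begin
  (toℕ (backward (backward i)) + toℕ (backward i)) % m   ≡⟨ backward-≈ (backward i) ⟩
  0 % m                                                  ≡⟨ backward-≈ i ⟨
  (toℕ (backward i) + toℕ i) % m                         ≡⟨ cong (_% m) (+-comm (toℕ (backward i)) (toℕ i)) ⟩
  (toℕ i + toℕ (backward i)) % m                         ∎)))
  where open ≡-Reasoning

∧-elimˡ : ∀ {a b} → a ∧ b ≡ true → a ≡ true
∧-elimˡ {true} e = refl

∧-elimʳ : ∀ {a b} → a ∧ b ≡ true → b ≡ true
∧-elimʳ {true} e = e

∨-elim : ∀ {a b} → a ∨ b ≡ true → a ≡ true ⊎ b ≡ true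
∨-elim {true} e = inj₁ refl
∨-elim {false} e = inj₂ e

dec-sound : ∀ {P : Set} (P? : Dec P) → does P? ≡ true → P
dec-sound (yes p) _ = p

allᵇ anyᵇ : ∀ {n} → (Fin n → Bool) → Bool
allᵇ {zero} P = true
allᵇ {suc n} P = P zero ∧ allᵇ (P ∘ suc)
anyᵇ {zero} P = false
anyᵇ {suc n} P = P zero ∨ anyᵇ (P ∘ suc)

allᵇ-sound : ∀ {n} {P : Fin n → Bool} → allᵇ P ≡ true → ∀ i → P i ≡ true
allᵇ-sound e zero = ∧-elimˡ e
allᵇ-sound e (suc i) = allᵇ-sound (∧-elimʳ e) i

anyᵇ-sound : ∀ {n} {P : Fin n → Bool} → anyᵇ P ≡ true → ∃ λ i → P i ≡ true
anyᵇ-sound {suc n} e with ∨-elim e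
... | inj₁ p = zero , p
... | inj₂ p with i , q ← anyᵇ-sound p = suc i , q

module Exhaustive {n k l g′ : ℕ} (nb : Fin n → Fin k → Fin n) (cell : Fin n → Fin l → Fin (suc g′) → Fin n) where

  private
    g = suc g′
    V = Fin n

    _==_ : V → V → Bool
    u == v = does (u Fin.≟ v)

    _∈ᵇ_ : V → List V → Bool
    u ∈ᵇ [] = false
    u ∈ᵇ (v ∷ vs) = (u == v) ∨ (u ∈ᵇ vs)

    _≡ᴸ_ : List V → List V → Bool
    us ≡ᴸ vs = does (≡-dec Fin._≟_ us vs)

  -- Returns after one or two steps are no cycles and are let pass. Any other closed path has to be
  -- a cell, run through in one of its two directions.
  good : V → List V → Bool
  good a path = (length path <ᵇ 3) ∨ ((length path ≡ᵇ g) ∧ anyᵇ λ c →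
    (path ≡ᴸ trace (λ i → cell a c (i mod g)) g′) ∨ (path ≡ᴸ trace (λ i → cell a c (backward (i mod g))) g′))

  -- The list holds the vertices visited so far, the last one first and a at the end.
  search visit : ℕ → V → V → List V → Bool
  search zero a v path = true
  search (suc d) a v path = allᵇ λ p → visit d a (nb v p) path
  visit d a u path = if u == a then good a path else (if u ∈ᵇ path then true else search d a u (u ∷ path))

  visit-closing : ∀ d {a u} path → u ≡ a → visit d a u path ≡ true → good a path ≡ true
  visit-closing d {a} {u} path u≡a e rewrite dec-true (u Fin.≟ a) u≡a = e

  visit-fresh : ∀ d {a u} path → u ≢ a → (u ∈ᵇ path) ≡ false → visit d a u path ≡ true → search d a u (u ∷ path) ≡ true
  visit-fresh d {a} {u} path u≢a u∉path e rewrite dec-false (u Fin.≟ a) u≢a | u∉path = e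

  Symmetric : Set
  Symmetric = ∀ a p → ∃ λ q → nb (nb a p) q ≡ a

  symmetric? : Dec Symmetric
  symmetric? = all? λ a → all? λ p → any? λ q → nb (nb a p) q Fin.≟ a

  NbInjective : Set
  NbInjective = ∀ a p q → nb a p ≡ nb a q → p ≡ q

  nbInjective? : Dec NbInjective
  nbInjective? = all? λ a → all? λ p → all? λ q → (nb a p Fin.≟ nb a q) →-dec (p Fin.≟ q)

  Irreflexive : Set
  Irreflexive = ∀ a p → nb a p ≢ a

  irreflexive? : Dec Irreflexive
  irreflexive? = all? λ a → all? λ p → ¬? (nb a p Fin.≟ a)

  CellInjective : Set
  CellInjective = ∀ a c i j → cell a c i ≡ cell a c j → i ≡ j

  cellInjective? : Dec CellInjective
  cellInjective? = all? λ a → all? λ c → all? λ i → all? λ j → (cell a c i Fin.≟ cell a c j) →-dec (i Fin.≟ j)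

  CellAdjacent : Set
  CellAdjacent = ∀ a c i → Adjacent nb (cell a c i) (cell a c (suc (toℕ i) mod g))

  cellAdjacent? : Dec CellAdjacent
  cellAdjacent? = all? λ a → all? λ c → all? λ i → any? λ p → nb (cell a c i) p Fin.≟ cell a c (suc (toℕ i) mod g)

  CellStart : Set
  CellStart = ∀ a c → cell a c zero ≡ a

  cellStart? : Dec CellStart
  cellStart? = all? λ a → all? λ c → cell a c zero Fin.≟ a

  CellsDistinct : Set
  CellsDistinct = ∀ a c c′ → c ≡ c′ ⊎ ∃ λ i → ¬ EdgeOf (cell a c′) (cell a c i) (cell a c (suc (toℕ i) mod g))

  cellsDistinct? : Dec CellsDistinct
  cellsDistinct? = all? λ a → all? λ c → all? λ c′ → (c Fin.≟ c′) ⊎-dec any? λ i → ¬? (edgeOf? (cell a c′) _ _)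

  module _ {m′ : ℕ} (f : Fin (suc m′) → V) (cy : Cycle nb (suc m′) f) where

    private
      m = suc m′

      F : ℕ → V
      F i = f (i mod m)

      F-injective : ∀ {i j} → i < m → j < m → F i ≡ F j → i ≡ j
      F-injective {i} {j} i<m j<m e = begin
        i               ≡⟨ m<n⇒m%n≡m i<m ⟨
        i % m           ≡⟨ toℕ-mod i m ⟨
        toℕ (i mod m)   ≡⟨ cong toℕ (proj₁ cy _ _ e) ⟩
        toℕ (j mod m)   ≡⟨ toℕ-mod j m ⟩
        j % m           ≡⟨ m<n⇒m%n≡m j<m ⟩
        j               ∎
        where open ≡-Reasoning

      fresh : ∀ i j → i < j → j < m → (F j ∈ᵇ trace F i) ≡ false
      fresh zero j i<j j<m rewrite dec-false (F j Fin.≟ F 0) (λ e → <⇒≢ i<j (sym (F-injective j<m z<s e))) = refl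
      fresh (suc i) j i<j j<m
        rewrite dec-false (F j Fin.≟ F (suc i)) (λ e → <⇒≢ i<j (sym (F-injective j<m (<-trans i<j j<m) e))) =
        fresh i j (<-trans (n<1+n i) i<j) j<m

    -- The search tries all neighbours, so one of its branches follows the given cycle: after `i`
    -- steps the path is `trace F i`, and the next vertex is new until the cycle closes. The bound
    -- `m ≤ i + d` keeps the search from stopping before that.
    search-sound : ∀ d i → i < m → m ≤ i + d → search d (F 0) (F i) (trace F i) ≡ true → good (F 0) (trace F m′) ≡ true
    search-sound zero i i<m m≤i+d _ = contradiction (≤-trans i<m m≤i+d) (<-irrefl (sym (+-identityʳ i)))
    search-sound (suc d) i i<m m≤i+d e with proj₂ cy _ _ (mod-consecutive i m)
    ... | p , np with m≤n⇒m<n∨m≡n i<m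
    ... | inj₂ refl = visit-closing d (trace F i) (trans np (cong f (mod-cong {m} {0} m (n%n≡0 m)))) (allᵇ-sound e p)
    ... | inj₁ si<m = search-sound d (suc i) si<m (≤-trans m≤i+d (≤-reflexive (+-suc i d)))
      (visit-fresh d (trace F i) (λ e → 1+n≢0 (F-injective si<m z<s e)) (fresh i (suc i) (n<1+n i) si<m)
        (subst (λ u → visit d (F 0) u (trace F i) ≡ true) np (allᵇ-sound e p)))

  Searched : Set
  Searched = allᵇ (λ a → search g a a (a ∷ [])) ≡ true

  module _ (searched : Searched) where

    private
      goodCycle : ∀ m′ (f : Fin (suc m′) → V) → Cycle nb (suc m′) f → suc m′ ≤ g → good (f (0 mod suc m′)) (trace (λ i → f (i mod suc m′)) m′) ≡ true
      goodCycle m′ f cy m≤g = search-sound f cy g 0 z<s m≤g (allᵇ-sound searched (f (0 mod suc m′)))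

    short⇒⊥ : ∀ m f → 3 ≤ m → m < g → ¬ Cycle nb m f
    short⇒⊥ (suc m′) f 3≤m m<g cy with ∨-elim (goodCycle m′ f cy (<⇒≤ m<g))
    ... | inj₁ len = <⇒≱ (<ᵇ⇒< _ 3 (subst IsTrue (sym len) tt)) (≤-trans 3≤m (≤-reflexive (sym (length-trace _ m′))))
    ... | inj₂ e = <⇒≢ m<g (trans (sym (length-trace _ m′)) (≡ᵇ⇒≡ _ g (subst IsTrue (sym (∧-elimˡ e)) tt)))

    completeAt0 : 3 ≤ g → ∀ f → Cycle nb g f → ∃ λ c → cell (f (0 mod g)) c ≋ f
    completeAt0 3≤g f cy with ∨-elim (goodCycle g′ f cy ≤-refl)
    ... | inj₁ len = contradiction (≤-trans 3≤g (≤-reflexive (sym (length-trace _ g′)))) (<⇒≱ (<ᵇ⇒< _ 3 (subst IsTrue (sym len) tt)))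
    ... | inj₂ e with c , e′ ← anyᵇ-sound (∧-elimʳ {length (trace (λ i → f (i mod g)) g′) ≡ᵇ g} e) with ∨-elim e′
    ... | inj₁ fwd = c , ≗⇒≋ λ i → sym (trans (cong f (sym (toℕ-mod-id i)))
      (trans (trace-injective g′ (dec-sound (≡-dec Fin._≟_ _ _) fwd) (toℕ i) (≤-pred (toℕ<n i))) (cong (cell _ c) (toℕ-mod-id i))))
    ... | inj₂ bwd = c , ⊑-reversing backward backward-consecutive (λ i → sym (trans (mirror (backward i)) (cong (cell _ c) (backward-involutive i)))) ,
        ⊑-reversing backward backward-consecutive mirror
      where
      mirror : ∀ i → f i ≡ cell (f (0 mod g)) c (backward i)
      mirror i = trans (cong f (sym (toℕ-mod-id i)))
        (trans (trace-injective g′ (dec-sound (≡-dec Fin._≟_ _ _) bwd) (toℕ i) (≤-pred (toℕ<n i))) (cong (λ j → cell _ c (backward j)) (toℕ-mod-id i)))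

  verified : {{True (3 ≤? g)}} → V →
    {_ : True symmetric?} {_ : True nbInjective?} {_ : True irreflexive?} {_ : True cellInjective?}
    {_ : True cellAdjacent?} {_ : True cellStart?} {_ : True cellsDistinct?} → Searched → CellSystem k g l
  verified {{3≤g}} o {sy} {ni} {ir} {ci} {ca} {cs} {cd} searched = record
    { index = ↔-id V
    ; origin = o
    ; nb = nb
    ; nb-injective = λ a {p} {q} → toWitness ni a p q
    ; nb-symmetric = toWitness sy
    ; nb-irreflexive = toWitness ir
    ; cell = cell
    ; cell-cycle = λ a c → toWitness ci a c , λ i j cn →
        subst (λ j → Adjacent nb (cell a c i) (cell a c j)) (sym (consecutive⇒mod cn)) (toWitness ca a c i)
    ; cell-through = λ a c → zero , toWitness cs a c
    ; cell-separated = λ a c c′ sub → [ id , (λ (i , ¬e) → contradiction (sub _ _ (edgeOf-next (cell a c) i)) ¬e) ]′ (toWitness cd a c c′)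
    ; no-short-cycle = short⇒⊥ searched
    ; cell-complete = λ f cy i →
        -- The search only recognises cycles from their vertex at index 0, so the cycle is rotated
        -- to begin at index `i`.
        let c , same = completeAt0 searched (toWitness 3≤g) (f ∘ shift (toℕ i)) (cycle-shift nb (toℕ i) cy)
        in c , ≋-trans (subst (λ x → cell x c ≋ (f ∘ shift (toℕ i))) (cong f (shift-0 i)) same) (rotate-≋ f i)
    }
    where
    shift-0 : ∀ (i : Fin g) → shift (toℕ i) (0 mod g) ≡ i
    shift-0 i = trans (cong (_mod g) (+-identityʳ (toℕ i))) (toℕ-mod-id i)

-- Explicit small graphs

follow : ∀ {n k m} → (Fin n → Fin k → Fin n) → Fin n → Vec (Fin k) m → ℕ → Fin n
follow nb a [] i = a
follow nb a (p ∷ ps) zero = a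
follow nb a (p ∷ ps) (suc i) = follow nb (nb a p) ps i

module Circulant (n : ℕ) .{{_ : NonZero n}} {k l g : ℕ} (steps : Vec ℕ k) (routes : Vec (Vec (Fin k) g) l) where

  nb : Fin n → Fin k → Fin n
  nb a p = (toℕ a + lookup steps p) mod n

  cell : Fin n → Fin l → Fin g → Fin n
  cell a c i = follow nb a (lookup routes c) (toℕ i)

-- A factor without triangles: in a product it raises the degree by one and leaves the number of
-- triangles alone.
K₂ : CellSystem 1 3 0
K₂ = verified zero refl
  where
  open Circulant 2 {g = 3} (1 ∷ []) []
  open Exhaustive nb cell

K₃ : CellSystem 2 3 1
K₃ = verified zero refl
  where
  open Circulant 3 (1 ∷ 2 ∷ []) ((# 0 ∷ # 0 ∷ # 0 ∷ []) ∷ [])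
  open Exhaustive nb cell

K₄ : CellSystem 3 3 3
K₄ = verified zero refl
  where
  open Circulant 4 (1 ∷ 2 ∷ 3 ∷ [])
    ((# 0 ∷ # 0 ∷ # 1 ∷ []) ∷ (# 0 ∷ # 1 ∷ # 0 ∷ []) ∷ (# 1 ∷ # 0 ∷ # 0 ∷ []) ∷ [])
  open Exhaustive nb cell

-- Each residue modulo 6 is adjacent to all others except its antipode, which differs by 3.
octahedron : CellSystem 4 3 4
octahedron = verified zero refl
  where
  open Circulant 6 (1 ∷ 2 ∷ 4 ∷ 5 ∷ [])
    ((# 0 ∷ # 0 ∷ # 2 ∷ []) ∷ (# 0 ∷ # 2 ∷ # 0 ∷ []) ∷ (# 2 ∷ # 0 ∷ # 0 ∷ []) ∷ (# 1 ∷ # 1 ∷ # 1 ∷ []) ∷ [])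
  open Exhaustive nb cell

-- Neighbours are listed in cyclic order around each vertex
icosahedron : CellSystem 5 3 5
icosahedron = verified zero refl
  where
  table : Vec (Vec ℕ 5) 12
  table =
    (1 ∷ 2 ∷ 3 ∷ 4 ∷ 5 ∷ []) ∷ (0 ∷ 2 ∷ 6 ∷ 10 ∷ 5 ∷ []) ∷ (0 ∷ 3 ∷ 7 ∷ 6 ∷ 1 ∷ []) ∷
    (0 ∷ 4 ∷ 8 ∷ 7 ∷ 2 ∷ []) ∷ (0 ∷ 5 ∷ 9 ∷ 8 ∷ 3 ∷ []) ∷ (0 ∷ 1 ∷ 10 ∷ 9 ∷ 4 ∷ []) ∷
    (11 ∷ 10 ∷ 1 ∷ 2 ∷ 7 ∷ []) ∷ (11 ∷ 6 ∷ 2 ∷ 3 ∷ 8 ∷ []) ∷ (11 ∷ 7 ∷ 3 ∷ 4 ∷ 9 ∷ []) ∷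
    (11 ∷ 8 ∷ 4 ∷ 5 ∷ 10 ∷ []) ∷ (11 ∷ 9 ∷ 5 ∷ 1 ∷ 6 ∷ []) ∷ (6 ∷ 7 ∷ 8 ∷ 9 ∷ 10 ∷ []) ∷ []
  nb : Fin 12 → Fin 5 → Fin 12
  nb a p = lookup (lookup table a) p mod 12
  cell : Fin 12 → Fin 5 → Fin 3 → Fin 12
  cell a c zero = a
  cell a c (suc zero) = nb a c
  cell a c (suc (suc i)) = nb a (suc (toℕ c) mod 5)
  open Exhaustive nb cell

-- The honeycomb on a torus with 13 hexagons: vertices i and 13 + j are
-- adjacent when j - i is 0, 1 or 4 modulo 13.
honeycomb : CellSystem 3 6 3
honeycomb = verified zero refl
  where
  differences : Vec ℕ 3
  differences = 0 ∷ 1 ∷ 4 ∷ []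
  nb : Fin 26 → Fin 3 → Fin 26
  -- For `a` = 13 + j the subtraction is exact, since the differences are below 13, and the result
  -- is j minus the difference modulo 13.
  nb a p = (if toℕ a <ᵇ 13 then 13 + (toℕ a + lookup differences p) % 13 else (toℕ a ∸ lookup differences p) % 13) mod 26
  cell : Fin 26 → Fin 3 → Fin 6 → Fin 26
  -- Around a hexagon of the honeycomb the three edge directions occur twice, in cyclic order.
  cell a c i = follow nb a (port 0 ∷ port 1 ∷ port 2 ∷ port 0 ∷ port 1 ∷ port 2 ∷ []) (toℕ i)
    where
    port : ℕ → Fin 3
    port j = (toℕ c + j) mod 3
  open Exhaustive nb cell

-- A cover, with group ℤ/8, of a graph on 7 vertices: 8i + t is the lift t of
-- the vertex i.  The routes describe the 7-cycles through the lifts of i.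
heptagonal : CellSystem 3 7 3
heptagonal = verified zero refl
  where
  base : Vec (Vec ℕ 3) 7
  base =
    (9 ∷ 37 ∷ 55 ∷ []) ∷ (24 ∷ 7 ∷ 41 ∷ []) ∷ (36 ∷ 21 ∷ 19 ∷ []) ∷ (42 ∷ 8 ∷ 53 ∷ []) ∷
    (20 ∷ 52 ∷ 3 ∷ []) ∷ (30 ∷ 15 ∷ 44 ∷ []) ∷ (27 ∷ 36 ∷ 1 ∷ []) ∷ []
  routes : Vec (Vec (Vec ℕ 7) 3) 7
  routes =
    ((0 ∷ 0 ∷ 0 ∷ 1 ∷ 0 ∷ 2 ∷ 2 ∷ []) ∷ (0 ∷ 2 ∷ 2 ∷ 0 ∷ 2 ∷ 1 ∷ 2 ∷ []) ∷ (1 ∷ 0 ∷ 2 ∷ 2 ∷ 0 ∷ 1 ∷ 2 ∷ []) ∷ []) ∷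
    ((0 ∷ 2 ∷ 2 ∷ 0 ∷ 0 ∷ 0 ∷ 1 ∷ []) ∷ (1 ∷ 1 ∷ 1 ∷ 0 ∷ 0 ∷ 2 ∷ 1 ∷ []) ∷ (1 ∷ 2 ∷ 0 ∷ 1 ∷ 2 ∷ 0 ∷ 1 ∷ []) ∷ []) ∷
    ((1 ∷ 1 ∷ 0 ∷ 2 ∷ 2 ∷ 1 ∷ 0 ∷ []) ∷ (2 ∷ 0 ∷ 1 ∷ 2 ∷ 1 ∷ 0 ∷ 2 ∷ []) ∷ (2 ∷ 2 ∷ 0 ∷ 1 ∷ 2 ∷ 1 ∷ 0 ∷ []) ∷ []) ∷
    ((0 ∷ 2 ∷ 1 ∷ 1 ∷ 1 ∷ 1 ∷ 0 ∷ []) ∷ (1 ∷ 1 ∷ 2 ∷ 0 ∷ 1 ∷ 2 ∷ 0 ∷ []) ∷ (1 ∷ 2 ∷ 0 ∷ 1 ∷ 1 ∷ 2 ∷ 0 ∷ []) ∷ []) ∷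
    ((0 ∷ 1 ∷ 1 ∷ 0 ∷ 2 ∷ 2 ∷ 1 ∷ []) ∷ (2 ∷ 0 ∷ 2 ∷ 2 ∷ 0 ∷ 2 ∷ 1 ∷ []) ∷ (2 ∷ 2 ∷ 1 ∷ 0 ∷ 1 ∷ 1 ∷ 0 ∷ []) ∷ []) ∷
    ((0 ∷ 2 ∷ 1 ∷ 2 ∷ 0 ∷ 2 ∷ 2 ∷ []) ∷ (1 ∷ 0 ∷ 2 ∷ 2 ∷ 0 ∷ 0 ∷ 0 ∷ []) ∷ (1 ∷ 1 ∷ 1 ∷ 1 ∷ 0 ∷ 0 ∷ 2 ∷ []) ∷ []) ∷
    ((0 ∷ 0 ∷ 2 ∷ 1 ∷ 1 ∷ 1 ∷ 1 ∷ []) ∷ (2 ∷ 0 ∷ 0 ∷ 0 ∷ 1 ∷ 0 ∷ 2 ∷ []) ∷ (2 ∷ 1 ∷ 0 ∷ 2 ∷ 2 ∷ 0 ∷ 1 ∷ []) ∷ []) ∷ []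
  fibre : Fin 56 → Fin 7
  fibre a = (toℕ a / 8) mod 7
  nb : Fin 56 → Fin 3 → Fin 56
  -- The entry `x` encodes the end of a base edge as `x / 8` and its voltage as `x % 8`. Modulo 8
  -- the fibre numbers in `x` and `a` vanish, so the new lift is the old one plus the voltage.
  nb a p = (x / 8 * 8 + (x + toℕ a) % 8) mod 56
    where
    x = lookup (lookup base (fibre a)) p
  cell : Fin 56 → Fin 3 → Fin 7 → Fin 56
  cell a c i = follow nb a (Vec.map (_mod 3) (lookup (lookup routes (fibre a)) c)) (toℕ i)
  open Exhaustive nb cell

-- Finite actions without short relations

module Words {A : Set} (inv : A → A) where

  -- The head of a word is the letter that acts last.
  data Reduced : List A → Set where
    []   : Reduced []
    [_]  : ∀ a → Reduced (a ∷ [])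
    _∷_  : ∀ {a b w} → a ≢ inv b → Reduced (b ∷ w) → Reduced (a ∷ b ∷ w)

  act* : ∀ {T : Set} → (A → T → T) → List A → T → T
  act* act [] t = t
  act* act (a ∷ w) t = act a (act* act w t)

  reduced-tail : ∀ {a w} → Reduced (a ∷ w) → Reduced w
  reduced-tail [ a ] = []
  reduced-tail (_ ∷ r) = r

  act*-∷ʳ : ∀ {T : Set} (act : A → T → T) w a t → act* act (w ∷ʳ a) t ≡ act* act w (act a t)
  act*-∷ʳ act [] a t = refl
  act*-∷ʳ act (b ∷ w) a t = cong (act b) (act*-∷ʳ act w a t)

  reduced-init : ∀ w {a} → Reduced (w ∷ʳ a) → Reduced w
  reduced-init [] r = []
  reduced-init (b ∷ []) r = [ b ]
  reduced-init (b ∷ c ∷ w) (b≢ ∷ r) = b≢ ∷ reduced-init (c ∷ w) r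

module _ {A : Set} (inv : A → A) where
  open Words inv

  record FreeAction (N : ℕ) : Set where
    field
      points : ℕ
      origin : Fin points
      act    : A → Fin points → Fin points
      act-inv : ∀ a t → act (inv a) (act a t) ≡ t
      act-free : ∀ w → Reduced w → 0 < length w → length w ≤ N → ∀ t → act* act w t ≢ t

module Construction {A : Set} (inv : A → A) (inv-involutive : ∀ a → inv (inv a) ≡ a)
  {K : ℕ} (code : A → Fin K) (code-injective : ∀ {a b} → code a ≡ code b → a ≡ b) where

  open Words inv

  swap : FreeAction inv 1
  swap = record
    { points = 2
    ; origin = zero
    ; act = λ _ → opposite
    ; act-inv = λ _ → opposite-involutive
    ; act-free = λ { (a ∷ []) _ _ _ zero () ; (a ∷ []) _ _ _ (suc zero) () ; (a ∷ b ∷ w) _ _ (s≤s ()) }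
    }

  -- The vertices of the new graph are the pairs of an old vertex t and a bit
  -- for every old dart; traversing an edge flips the bits of its two darts.
  -- A closed walk of length N + 1 without backtracking would traverse the last
  -- dart exactly once, so it does not lift to a closed walk.
  module Lift {N : ℕ} (𝒜 : FreeAction inv (suc N)) where

    open FreeAction 𝒜

    bits : ℕ
    bits = points * K

    dart : Fin points → A → Fin bits
    dart t a = combine t (code a)

    dart-injective : ∀ {t a t′ a′} → dart t a ≡ dart t′ a′ → t ≡ t′ × a ≡ a′
    dart-injective {t} {a} {t′} {a′} e with p , q ← combine-injective t (code a) t′ (code a′) e = p , code-injective q

    flipIf : ∀ {P : Set} → Dec P → Fin 2 → Fin 2
    flipIf (yes _) = opposite
    flipIf (no _) = id

    flipIf-twice : ∀ {P : Set} (P? : Dec P) b → flipIf P? (flipIf P? b) ≡ b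
    flipIf-twice (yes _) b = opposite-involutive b
    flipIf-twice (no _) b = refl

    flipIf-no : ∀ {P : Set} (P? : Dec P) {b} → ¬ P → flipIf P? b ≡ b
    flipIf-no (yes p) ¬p = contradiction p ¬p
    flipIf-no (no _) _ = refl

    flipIf-yes : ∀ {P : Set} (P? : Dec P) {b} → P → flipIf P? b ≢ b
    flipIf-yes (yes _) {zero} _ ()
    flipIf-yes (yes _) {suc zero} _ ()
    flipIf-yes (no ¬p) p = contradiction p ¬p

    -- Bit vectors are stored as numbers, so that states with equal bits are equal without function
    -- extensionality.
    State : Set
    State = Fin (2 ^ bits)

    -- Flipping both darts of an edge makes the step back along the edge undo the step.
    flip : Fin bits → Fin bits → State → State
    flip d d′ φ = funToFin λ e → flipIf (e Fin.≟ d) (flipIf (e Fin.≟ d′) (finToFun φ e))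

    funToFin-cong : ∀ {m n} {f h : Fin m → Fin n} → (∀ i → f i ≡ h i) → funToFin f ≡ funToFin h
    funToFin-cong {zero} e = refl
    funToFin-cong {suc m} e = cong₂ combine (e zero) (funToFin-cong (e ∘ suc))

    flip-flip : ∀ d d′ φ → flip d′ d (flip d d′ φ) ≡ φ
    flip-flip d d′ φ = trans (funToFin-cong pointwise) (funToFin-finToFin {bits} φ)
      where
      pointwise : ∀ e → flipIf (e Fin.≟ d′) (flipIf (e Fin.≟ d) (finToFun (flip d d′ φ) e)) ≡ finToFun φ e
      pointwise e = begin
        flipIf D′ (flipIf D (finToFun (flip d d′ φ) e))      ≡⟨ cong (flipIf D′ ∘ flipIf D) (finToFun-funToFin _ e) ⟩
        flipIf D′ (flipIf D (flipIf D (flipIf D′ (finToFun φ e))))  ≡⟨ cong (flipIf D′) (flipIf-twice D _) ⟩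
        flipIf D′ (flipIf D′ (finToFun φ e))                 ≡⟨ flipIf-twice D′ _ ⟩
        finToFun φ e                                         ∎
        where
        open ≡-Reasoning
        D = e Fin.≟ d
        D′ = e Fin.≟ d′

    step : A → Fin points × State → Fin points × State
    step a (t , φ) = act a t , flip (dart t a) (dart (act a t) (inv a)) φ

    step-inv : ∀ a x → step (inv a) (step a x) ≡ x
    step-inv a (t , φ) = cong₂ _,_ (act-inv a t) (begin
      flip (dart (act a t) (inv a)) (dart (act (inv a) (act a t)) (inv (inv a))) ψ
        ≡⟨ cong₂ (λ s b → flip (dart (act a t) (inv a)) (dart s b) ψ) (act-inv a t) (inv-involutive a) ⟩
      flip (dart (act a t) (inv a)) (dart t a) ψ
        ≡⟨ flip-flip (dart t a) (dart (act a t) (inv a)) φ ⟩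
      φ ∎)
      where
      open ≡-Reasoning
      ψ = flip (dart t a) (dart (act a t) (inv a)) φ

    step*-proj₁ : ∀ w x → proj₁ (act* step w x) ≡ act* act w (proj₁ x)
    step*-proj₁ [] x = refl
    step*-proj₁ (a ∷ w) x = cong (act a) (step*-proj₁ w x)

    bit : Fin points × State → Fin bits → Fin 2
    bit (_ , φ) = finToFun φ

    bit-step : ∀ a x e → bit (step a x) e ≡
      flipIf (e Fin.≟ dart (proj₁ x) a) (flipIf (e Fin.≟ dart (act a (proj₁ x)) (inv a)) (bit x e))
    bit-step a x e = finToFun-funToFin _ e

    -- By freeness the walk never comes back to `t`, so only its first step can flip a dart at `t`.
    -- That step flips the dart `inv a` only if its letter is `inv a`, and the first letter to act
    -- is the last one in the list `w`.
    bit-unchanged : ∀ w a t φ → Reduced w → length w ≤ suc N → (∀ v → w ≢ v ∷ʳ inv a) →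
      bit (act* step w (t , φ)) (dart t (inv a)) ≡ finToFun φ (dart t (inv a))
    bit-unchanged [] a t φ _ _ _ = refl
    bit-unchanged (c ∷ w) a t φ r len ends = begin
      bit (step c x) e          ≡⟨ bit-step c x e ⟩
      flipIf D (flipIf D′ (bit x e))
        ≡⟨ flipIf-no D (λ q → start w ends r len (dart-injective q)) ⟩
      flipIf D′ (bit x e)
        ≡⟨ flipIf-no D′ (λ q → act-free (c ∷ w) r z<s len t
             (trans (cong (act c) (sym (step*-proj₁ w (t , φ)))) (sym (proj₁ (dart-injective q))))) ⟩
      bit x e                   ≡⟨ bit-unchanged w a t φ (reduced-tail r) (<⇒≤ len) (λ v q → ends (c ∷ v) (cong (c ∷_) q)) ⟩
      finToFun φ e              ∎
      where
      open ≡-Reasoning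
      e = dart t (inv a)
      x = act* step w (t , φ)
      D = e Fin.≟ dart (proj₁ x) c
      D′ = e Fin.≟ dart (act c (proj₁ x)) (inv c)
      start : ∀ w → (∀ v → c ∷ w ≢ v ∷ʳ inv a) → Reduced (c ∷ w) → length (c ∷ w) ≤ suc N → ¬ (t ≡ proj₁ (act* step w (t , φ)) × inv a ≡ c)
      start [] ends r len (_ , q) = ends [] (cong (_∷ []) (sym q))
      start (b ∷ w) ends r len (q , _) = act-free (b ∷ w) (reduced-tail r) z<s (<⇒≤ len) t (sym (trans q (step*-proj₁ (b ∷ w) (t , φ))))

    act-injective : ∀ a {t s} → act a t ≡ s → t ≡ act (inv a) s
    act-injective a {t} refl = sym (act-inv a t)

    -- A closed walk that ends with the inverse of its first dart can be shortened at both ends.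
    not-conjugate : ∀ v a t → Reduced (a ∷ v ∷ʳ inv a) → length (a ∷ v ∷ʳ inv a) ≤ suc (suc N) → act* act (a ∷ v ∷ʳ inv a) t ≢ t
    not-conjugate [] a t (a≢ ∷ _) _ _ = a≢ (sym (inv-involutive a))
    not-conjugate (b ∷ v) a t r (s≤s len) e =
      act-free (b ∷ v) (reduced-init (b ∷ v) (reduced-tail r)) z<s
        (≤-trans (≤-trans (m≤m+n _ 1) (≤-reflexive (sym (length-++ (b ∷ v))))) len)
        (act (inv a) t)
        (trans (sym (act*-∷ʳ act (b ∷ v) (inv a) t)) (act-injective a e))

    conjugate? : ∀ w a → (∃ λ v → w ≡ v ∷ʳ inv a) ⊎ (∀ v → w ≢ v ∷ʳ inv a)
    conjugate? [] a = inj₂ λ { [] () ; (_ ∷ _) () }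
    conjugate? (b ∷ []) a with code b Fin.≟ code (inv a)
    ... | yes p = inj₁ ([] , cong (_∷ []) (code-injective p))
    ... | no ¬p = inj₂ λ { [] refl → ¬p refl ; (_ ∷ []) () ; (_ ∷ _ ∷ _) () }
    conjugate? (b ∷ c ∷ w) a with conjugate? (c ∷ w) a
    ... | inj₁ (v , p) = inj₁ (b ∷ v , cong (b ∷_) p)
    ... | inj₂ ¬p = inj₂ λ { [] () ; (_ ∷ v) eq → ¬p v (proj₂ (∷-injective eq)) }

    -- If the walk closes below, its last step enters `t` and flips the dart `(t , inv a)`. Unless
    -- the walk also left `t` by this dart, nothing else has flipped it, so the bit differs from its
    -- initial value. If it did leave by this dart, the word is a conjugate, and its inner part
    -- would be a shorter closed walk below.
    step-free : ∀ w → Reduced w → 0 < length w → length w ≤ suc (suc N) → ∀ x → act* step w x ≢ x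
    step-free (a ∷ []) r _ _ x e = act-free (a ∷ []) r z<s (s≤s z≤n) (proj₁ x) (cong proj₁ e)
    step-free (a ∷ b ∷ w) r _ len x@(t , φ) e with conjugate? (b ∷ w) a
    ... | inj₁ (v , eq) = not-conjugate v a t (subst (λ u → Reduced (a ∷ u)) eq r) (subst (λ u → length (a ∷ u) ≤ suc (suc N)) eq len)
      (subst (λ u → act* act (a ∷ u) t ≡ t) eq (trans (sym (step*-proj₁ (a ∷ b ∷ w) x)) (cong proj₁ e)))
    ... | inj₂ ends = flipIf-yes (d Fin.≟ dart (act a (proj₁ y)) (inv a)) (cong (λ s → dart s (inv a)) (sym (cong proj₁ e)))
      (begin
        flipIf (d Fin.≟ dart (act a (proj₁ y)) (inv a)) (bit y d)
          ≡⟨ flipIf-no (d Fin.≟ dart (proj₁ y) a) (λ q → act-free (b ∷ w) (reduced-tail r) z<s (≤-pred len) t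
               (trans (sym (step*-proj₁ (b ∷ w) x)) (sym (proj₁ (dart-injective q))))) ⟨
        flipIf (d Fin.≟ dart (proj₁ y) a) (flipIf (d Fin.≟ dart (act a (proj₁ y)) (inv a)) (bit y d))
          ≡⟨ bit-step a y d ⟨
        bit (step a y) d     ≡⟨ cong (λ z → bit z d) e ⟩
        finToFun φ d         ≡⟨ bit-unchanged (b ∷ w) a t φ (reduced-tail r) (≤-pred len) ends ⟨
        bit y d              ∎)
      where
      open ≡-Reasoning
      d = dart t (inv a)
      y = act* step (b ∷ w) x

    enc : Fin points × State → Fin (points * 2 ^ bits)
    enc (t , φ) = combine t φ

    dec : Fin (points * 2 ^ bits) → Fin points × State
    dec = remQuot (2 ^ bits)

    dec-enc : ∀ x → dec (enc x) ≡ x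
    dec-enc (t , φ) = remQuot-combine t φ

    enc-dec : ∀ i → enc (dec i) ≡ i
    enc-dec = combine-remQuot {points} (2 ^ bits)

    act′*-dec : ∀ w i → dec (act* (λ a → enc ∘ step a ∘ dec) w i) ≡ act* step w (dec i)
    act′*-dec [] i = refl
    act′*-dec (a ∷ w) i = trans (dec-enc _) (cong (step a) (act′*-dec w i))

    lift : FreeAction inv (suc (suc N))
    lift = record
      { points = points * 2 ^ bits
      ; origin = enc (origin , funToFin {bits} (λ _ → zero))
      ; act = λ a → enc ∘ step a ∘ dec
      ; act-inv = λ a i → trans (cong (enc ∘ step (inv a)) (dec-enc _)) (trans (cong enc (step-inv a (dec i))) (enc-dec i))
      ; act-free = λ w r nonempty len i e → step-free w r nonempty len (dec i) (trans (sym (act′*-dec w i)) (cong dec e))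
      }

  freeAction : ∀ N → FreeAction inv (suc N)
  freeAction zero = swap
  freeAction (suc N) = Lift.lift (freeAction N)

-- Cuts

-- A cut at b consists of the edges of ℤ/g that leave b (true) and b + h (false).
module Positions (g h : ℕ) .{{_ : NonZero g}} where

  edge : Bool → ℕ → ℕ
  edge true b = b
  edge false b = b + h

  -- The lower end of an edge is compared exactly and the upper end modulo `g`: in the uses below an
  -- edge starts below `g`, but it may lead from g - 1 to 0.
  Near : Fin g → ℕ → Set
  Near x b = ∃ λ s → toℕ x ≡ edge s b ⊎ toℕ x ≈[ g ] suc (edge s b)

  near? : ∀ x b → Dec (Near x b)
  near? x b = map′ [ (true ,_) , (false ,_) ]′ (λ { (true , p) → inj₁ p ; (false , p) → inj₂ p }) (near true ⊎-dec near false)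
    where
    near : ∀ s → Dec (toℕ x ≡ edge s b ⊎ toℕ x ≈[ g ] suc (edge s b))
    near s = (toℕ x ≟ edge s b) ⊎-dec (toℕ x % g ≟ suc (edge s b) % g)

module Alphabet (g r : ℕ) where

  Label : Set
  Label = Fin (suc r)

  data Letter : Set where
    σ : Bool → Label → Letter
    ρ : Fin g → Label → Letter

  inv : Letter → Letter
  inv (σ s ℓ) = σ (not s) ℓ
  inv (ρ x ℓ) = ρ x ℓ

  inv-involutive : ∀ a → inv (inv a) ≡ a
  inv-involutive (σ s ℓ) = cong (λ s → σ s ℓ) (not-involutive s)
  inv-involutive (ρ x ℓ) = refl

  label : Letter → Label
  label (σ s ℓ) = ℓ
  label (ρ x ℓ) = ℓ

  σ-injective : ∀ {s s′ ℓ ℓ′} → σ s ℓ ≡ σ s′ ℓ′ → s ≡ s′ × ℓ ≡ ℓ′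
  σ-injective refl = refl , refl

  ρ-injective : ∀ {x x′ ℓ ℓ′} → ρ x ℓ ≡ ρ x′ ℓ′ → x ≡ x′
  ρ-injective refl = refl

  kind : Letter → Fin (2 + g)
  kind (σ true ℓ) = zero
  kind (σ false ℓ) = suc zero
  kind (ρ x ℓ) = suc (suc x)

  code : Letter → Fin ((2 + g) * suc r)
  code a = combine (kind a) (label a)

  kind-label : ∀ {a a′} → kind a ≡ kind a′ → label a ≡ label a′ → a ≡ a′
  kind-label {σ true _} {σ true _} p refl = refl
  kind-label {σ false _} {σ false _} p refl = refl
  kind-label {ρ x _} {ρ .x _} refl refl = refl
  kind-label {σ true _} {σ false _} () _
  kind-label {σ false _} {σ true _} () _
  kind-label {σ true _} {ρ _ _} () _
  kind-label {σ false _} {ρ _ _} () _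
  kind-label {ρ _ _} {σ true _} () _
  kind-label {ρ _ _} {σ false _} () _

  code-injective : ∀ {a a′} → code a ≡ code a′ → a ≡ a′
  code-injective {a} {a′} e with p , q ← combine-injective (kind a) (label a) (kind a′) (label a′) e = kind-label p q

  _≟ᴸ_ : (a a′ : Letter) → Dec (a ≡ a′)
  a ≟ᴸ a′ = map′ code-injective (cong code) (code a Fin.≟ code a′)

-- The labels below cuts are cuts, at pos ℓ.  Every label ℓ except skip x gives
-- one edge at the vertices over x: an edge of the cut ℓ if x is an end of one,
-- and otherwise an edge with the letter ρ x ℓ to another vertex over x.
module CutGraph (g h : ℕ) .{{_ : NonZero g}} (2≤h : 2 ≤ h) (2h≤g : h + h ≤ g) (g≤1+2h : g ≤ suc (h + h))
  (r cuts : ℕ) (cuts≤ : cuts ≤ suc r) (pos : Fin (suc r) → ℕ) (pos< : ∀ ℓ → pos ℓ + h < g)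
  (skip : Fin g → Fin (suc r))
  (skip-far : ∀ x → ¬ (toℕ (skip x) < cuts × Positions.Near g h x (pos (skip x))))
  (𝒜 : FreeAction (Alphabet.inv g r) (suc g)) where

  open Positions g h
  open Alphabet g r

  pos<pos+h : ∀ ℓ → pos ℓ < pos ℓ + h
  pos<pos+h ℓ = ≤-trans (≤-reflexive (+-comm 1 (pos ℓ))) (+-monoʳ-≤ (pos ℓ) (≤-trans (s≤s z≤n) 2≤h))

  4≤g : 4 ≤ g
  4≤g = ≤-trans (+-mono-≤ 2≤h 2≤h) 2h≤g

  h<g : h < g
  h<g = ≤-trans (+-monoˡ-≤ h (≤-trans (n≤1+n 1) 2≤h)) 2h≤g

  edge< : ∀ s ℓ → edge s (pos ℓ) < g
  edge< true ℓ = ≤-<-trans (m≤m+n _ h) (pos< ℓ)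
  edge< false ℓ = pos< ℓ

  -- The number of steps upwards from the edge `s` of a cut to the other edge. The two edges divide
  -- the circle into arcs `h` and `g ∸ h`, neither shorter than `h`.
  δ : Bool → ℕ
  δ true = h
  δ false = g ∸ h

  h≤δ : ∀ s → h ≤ δ s
  h≤δ true = ≤-refl
  h≤δ false = m+n≤o⇒m≤o∸n h 2h≤g

  δ+δ : ∀ s → δ s + δ (not s) ≡ g
  δ+δ true = m+[n∸m]≡n (<⇒≤ h<g)
  δ+δ false = m∸n+n≡m (<⇒≤ h<g)

  2≤δ : ∀ s → 2 ≤ δ s
  2≤δ s = ≤-trans 2≤h (h≤δ s)

  2+δ≤g : ∀ s → 2 + δ s ≤ g
  2+δ≤g s = ≤-trans (+-monoˡ-≤ (δ s) (2≤δ (not s))) (≤-reflexive (trans (+-comm (δ (not s)) (δ s)) (δ+δ s)))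

  edge+δ : ∀ s b → edge s b + δ s ≈[ g ] edge (not s) b
  edge+δ true b = refl
  edge+δ false b = trans (cong (_% g) (trans (+-assoc b h (g ∸ h)) (cong (b +_) (m+[n∸m]≡n (<⇒≤ h<g))))) (≈-+g b)

  open Words inv
  open FreeAction 𝒜

  T : Set
  T = Fin points

  apply : Maybe Letter → T → T
  apply nothing t = t
  apply (just a) t = act a t

  act-moves : ∀ a t → act a t ≢ t
  act-moves a t = act-free (a ∷ []) [ a ] z<s (s≤s z≤n) t

  -- If different letters `a` and `b` agreed at `t`, the reduced word `inv b ∷ a ∷ []` would have a
  -- fixed point. So the move in T determines the letter of an edge.
  apply-injective : ∀ {u v t} → apply u t ≡ apply v t → u ≡ v
  apply-injective {nothing} {nothing} e = refl
  apply-injective {nothing} {just a} {t} e = contradiction (sym e) (act-moves a t)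
  apply-injective {just a} {nothing} {t} e = contradiction e (act-moves a t)
  apply-injective {just a} {just b} {t} e with inv b ≟ᴸ inv a
  ... | yes p = cong just (trans (sym (inv-involutive a)) (trans (cong inv (sym p)) (inv-involutive b)))
  ... | no ¬p = contradiction (trans (cong (act (inv b)) e) (act-inv b t))
    (act-free (inv b ∷ a ∷ []) (¬p ∷ [ a ]) z<s (s≤s (≤-trans (s≤s z≤n) 4≤g)) t)

  data Step (x : Fin g) : Maybe Letter → Fin g → Set where
    up      : ∀ {y} → suc (toℕ x) ≈[ g ] toℕ y → Step x nothing y
    down    : ∀ {y} → toℕ x ≈[ g ] suc (toℕ y) → Step x nothing y
    cutUp   : ∀ {y} s ℓ → toℕ ℓ < cuts → toℕ x ≡ edge s (pos ℓ) → suc (toℕ x) ≈[ g ] toℕ y → Step x (just (σ s ℓ)) y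
    cutDown : ∀ {y} s ℓ → toℕ ℓ < cuts → toℕ y ≡ edge s (pos ℓ) → toℕ x ≈[ g ] suc (toℕ y) → Step x (just (σ (not s) ℓ)) y
    loop    : ∀ {y} ℓ → y ≡ x → ℓ ≢ skip x → ¬ (toℕ ℓ < cuts × Near x (pos ℓ)) → Step x (just (ρ x ℓ)) y

  step-reverse : ∀ {x v y} → Step x v y → Step y (Maybe.map inv v) x
  step-reverse (up p) = down (sym p)
  step-reverse (down p) = up (sym p)
  step-reverse (cutUp s ℓ c e p) = cutDown s ℓ c e (sym p)
  step-reverse (cutDown s ℓ c e p) = subst (λ s′ → Step _ (just (σ s′ ℓ)) _) (sym (not-involutive s)) (cutUp s ℓ c e (sym p))
  step-reverse (loop ℓ refl n f) = loop ℓ refl n f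

  apply-inverse : ∀ v t → apply (Maybe.map inv v) (apply v t) ≡ t
  apply-inverse nothing t = refl
  apply-inverse (just a) t = act-inv a t

  next prev : Fin g → Fin g
  next x = suc (toℕ x) mod g
  prev x = (g ∸ 1 + toℕ x) mod g

  next-≈ : ∀ x → suc (toℕ x) ≈[ g ] toℕ (next x)
  next-≈ x = sym (trans (cong (_% g) (toℕ-mod (suc (toℕ x)) g)) (%-≈ (suc (toℕ x))))

  prev-≈ : ∀ x → toℕ x ≈[ g ] suc (toℕ (prev x))
  prev-≈ x = sym (begin
    suc (toℕ (prev x)) % g             ≡⟨ cong (λ n → suc n % g) (toℕ-mod (g ∸ 1 + toℕ x) g) ⟩
    suc ((g ∸ 1 + toℕ x) % g) % g      ≡⟨ ≈-+ {a = 1} refl (%-≈ (g ∸ 1 + toℕ x)) ⟩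
    suc (g ∸ 1 + toℕ x) % g            ≡⟨ cong (λ n → (n + toℕ x) % g) (m+[n∸m]≡n {1} (≤-trans (s≤s z≤n) 4≤g)) ⟩
    (g + toℕ x) % g                    ≡⟨ cong (_% g) (+-comm g (toℕ x)) ⟩
    (toℕ x + g) % g                    ≡⟨ ≈-+g (toℕ x) ⟩
    toℕ x % g                          ∎)
    where open ≡-Reasoning

  Fin-≈ : ∀ {x y : Fin g} → toℕ x ≈[ g ] toℕ y → x ≡ y
  Fin-≈ {x} {y} p = toℕ-injective (≈-small (toℕ<n x) (toℕ<n y) p)

  shifted-≉ : ∀ c {n} → 0 < c → c < g → ¬ (c + n ≈[ g ] n)
  shifted-≉ c {n} 0<c c<g p = <⇒≢ 0<c (sym (≈-small c<g (<-trans 0<c c<g) (≈-cancelʳ n {c} {0} p)))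

  Dart : Fin g → Set
  Dart x = ∃ λ v → ∃ λ y → Step x v y

  special : ∀ x ℓ → ℓ ≢ skip x → Dart x
  special x ℓ ℓ≢ with (toℕ ℓ <? cuts) ×-dec near? x (pos ℓ)
  ... | yes (c , s , inj₁ e) = just (σ s ℓ) , next x , cutUp s ℓ c e (next-≈ x)
  ... | yes (c , s , inj₂ e) = just (σ (not s) ℓ) , fromℕ< (edge< s ℓ) ,
    cutDown s ℓ c (toℕ-fromℕ< (edge< s ℓ)) (trans e (cong (λ n → suc n % g) (sym (toℕ-fromℕ< (edge< s ℓ)))))
  ... | no far = just (ρ x ℓ) , x , loop ℓ refl ℓ≢ far

  special-label : ∀ x ℓ ℓ≢ → Maybe.map label (proj₁ (special x ℓ ℓ≢)) ≡ just ℓ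
  special-label x ℓ ℓ≢ with (toℕ ℓ <? cuts) ×-dec near? x (pos ℓ)
  ... | yes (c , s , inj₁ e) = refl
  ... | yes (c , s , inj₂ e) = refl
  ... | no far = refl

  b+h≢b : ∀ b → b + h ≢ b
  b+h≢b b e = <⇒≢ (≤-trans (s≤s z≤n) 2≤h) (sym (+-cancelˡ-≡ b h 0 (trans e (sym (+-identityʳ b)))))

  edge-injective : ∀ s s′ b → edge s b ≡ edge s′ b → s ≡ s′
  edge-injective true true b _ = refl
  edge-injective false false b _ = refl
  edge-injective true false b p = contradiction (sym p) (b+h≢b b)
  edge-injective false true b p = contradiction p (b+h≢b b)

  -- Both arcs between the edges of a cut have at least two steps, so the four ends of a cut are
  -- distinct. A vertex therefore meets at most one edge of each cut, and a label determines the
  -- step.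
  edge≉suc-edge : ∀ s s′ b → ¬ (edge s b ≈[ g ] suc (edge s′ b))
  edge≉suc-edge s s′ b p with s Bool.≟ s′
  ... | yes refl = shifted-≉ 1 z<s (≤-trans (s≤s (s≤s z≤n)) 4≤g) (sym p)
  ... | no s≢s′ rewrite Bool.¬-not s≢s′ = shifted-≉ (suc (δ (not s′))) {edge (not s′) b} z<s
    (2+δ≤g (not s′)) (begin
      suc (δ (not s′) + edge (not s′) b) % g     ≡⟨ cong (λ n → suc n % g) (+-comm (δ (not s′)) _) ⟩
      suc (edge (not s′) b + δ (not s′)) % g     ≡⟨ ≈-+ {a = 1} refl (edge+δ (not s′) b) ⟩
      suc (edge (not (not s′)) b) % g            ≡⟨ cong (λ s → suc (edge s b) % g) (not-involutive s′) ⟩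
      suc (edge s′ b) % g                        ≡⟨ p ⟨
      edge (not s′) b % g                        ∎)
    where open ≡-Reasoning

  step-unique : ∀ {x a y a′ y′} → Step x (just a) y → Step x (just a′) y′ → label a ≡ label a′ → a ≡ a′ × y ≡ y′
  step-unique (cutUp s ℓ _ e p) (cutUp s′ .ℓ _ e′ p′) refl with refl ← edge-injective s s′ (pos ℓ) (trans (sym e) e′) =
    refl , Fin-≈ (trans (sym p) p′)
  step-unique (cutUp s ℓ _ e p) (cutDown s′ .ℓ _ e′ p′) refl =
    contradiction (trans (cong (_% g) (sym e)) (trans p′ (cong (λ n → suc n % g) e′))) (edge≉suc-edge s s′ (pos ℓ))
  step-unique (cutDown s ℓ _ e p) (cutUp s′ .ℓ _ e′ p′) refl =
    contradiction (trans (cong (_% g) (sym e′)) (trans p (cong (λ n → suc n % g) e))) (edge≉suc-edge s′ s (pos ℓ))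
  step-unique (cutDown s ℓ _ e p) (cutDown s′ .ℓ _ e′ p′) refl with y≡y′ ← Fin-≈ (≈-cancelˡ 1 (trans (sym p) p′)) =
    cong (λ s → σ (not s) ℓ) (edge-injective s s′ (pos ℓ) (trans (sym e) (trans (cong toℕ y≡y′) e′))) , y≡y′
  step-unique (loop ℓ e _ _) (loop .ℓ e′ _ _) refl = refl , trans e (sym e′)
  step-unique (cutUp s ℓ c e p) (loop .ℓ _ _ far) refl = contradiction (c , s , inj₁ e) far
  step-unique (cutDown s ℓ c e p) (loop .ℓ _ _ far) refl = contradiction (c , s , inj₂ (trans p (cong (λ n → suc n % g) e))) far
  step-unique (loop ℓ _ _ far) (cutUp s .ℓ c e p) refl = contradiction (c , s , inj₁ e) far
  step-unique (loop ℓ _ _ far) (cutDown s .ℓ c e p) refl = contradiction (c , s , inj₂ (trans p (cong (λ n → suc n % g) e))) far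

  step-not-skipped : ∀ {x a y} → Step x (just a) y → label a ≢ skip x
  step-not-skipped {x} (cutUp s ℓ c e p) refl = skip-far x (c , s , inj₁ e)
  step-not-skipped {x} (cutDown s ℓ c e p) refl = skip-far x (c , s , inj₂ (trans p (cong (λ n → suc n % g) e)))
  step-not-skipped (loop ℓ _ n _) = n

  dart : ∀ x → Fin (2 + r) → Dart x
  dart x zero = nothing , next x , up (next-≈ x)
  dart x (suc zero) = nothing , prev x , down (prev-≈ x)
  dart x (suc (suc j)) = special x (punchIn (skip x) j) (punchInᵢ≢i (skip x) j)

  Vertex : Set
  Vertex = T × Fin g

  nb : Vertex → Fin (2 + r) → Vertex
  nb (t , x) p = apply (proj₁ (dart x p)) t , proj₁ (proj₂ (dart x p))

  adjacent⁻ : ∀ {t x t′ x′} → Adjacent nb (t , x) (t′ , x′) → ∃ λ v → Step x v x′ × apply v t ≡ t′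
  adjacent⁻ {x = x} (p , refl) = proj₁ (dart x p) , proj₂ (proj₂ (dart x p)) , refl

  -- The label of a lettered step is never the skipped one, so some number is assigned to it, and
  -- `step-unique` identifies the step with the numbered one.
  adjacent⁺ : ∀ {x v y} t → Step x v y → Adjacent nb (t , x) (apply v t , y)
  adjacent⁺ {x} {nothing} t (up p) = zero , cong (t ,_) (Fin-≈ (trans (sym (next-≈ x)) p))
  adjacent⁺ {x} {nothing} t (down p) = suc zero , cong (t ,_) (Fin-≈ (≈-cancelˡ 1 (trans (sym (prev-≈ x)) p)))
  adjacent⁺ {x} {just a} {y} t st = suc (suc j) , found (special x (punchIn (skip x) j) _) (special-label x _ _)
    where
    skipped : skip x ≢ label a
    skipped = step-not-skipped st ∘ sym
    j = punchOut skipped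
    found : (d : Dart x) → Maybe.map label (proj₁ d) ≡ just (punchIn (skip x) j) → (apply (proj₁ d) t , proj₁ (proj₂ d)) ≡ (act a t , y)
    found (just a′ , y′ , st′) e with step-unique st′ st (trans (just-injective e) (punchIn-punchOut skipped))
    ... | refl , refl = refl

  special-letter : ∀ x ℓ ℓ≢ → proj₁ (special x ℓ ℓ≢) ≢ nothing
  special-letter x ℓ ℓ≢ e with () ← trans (sym (special-label x ℓ ℓ≢)) (cong (Maybe.map label) e)

  next≢prev : ∀ x → next x ≢ prev x
  next≢prev x e = shifted-≉ 2 {toℕ x} z<s (≤-trans (s≤s (s≤s (s≤s z≤n))) 4≤g) (begin
    suc (suc (toℕ x)) % g        ≡⟨ ≈-+ {a = 1} refl (next-≈ x) ⟩
    suc (toℕ (next x)) % g       ≡⟨ cong (λ y → suc (toℕ y) % g) e ⟩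
    suc (toℕ (prev x)) % g       ≡⟨ prev-≈ x ⟨
    toℕ x % g                    ∎)
    where open ≡-Reasoning

  nb-injective : ∀ a {p q} → nb a p ≡ nb a q → p ≡ q
  nb-injective (t , x) {p} {q} e = go p q (apply-injective (cong proj₁ e)) (cong proj₂ e)
    where
    go : ∀ p q → proj₁ (dart x p) ≡ proj₁ (dart x q) → proj₁ (proj₂ (dart x p)) ≡ proj₁ (proj₂ (dart x q)) → p ≡ q
    go zero zero _ _ = refl
    go zero (suc zero) _ e = contradiction e (next≢prev x)
    go (suc zero) zero _ e = contradiction (sym e) (next≢prev x)
    go (suc zero) (suc zero) _ _ = refl
    go zero (suc (suc j)) e _ = contradiction (sym e) (special-letter x _ _)
    go (suc zero) (suc (suc j)) e _ = contradiction (sym e) (special-letter x _ _)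
    go (suc (suc j)) zero e _ = contradiction e (special-letter x _ _)
    go (suc (suc j)) (suc zero) e _ = contradiction e (special-letter x _ _)
    go (suc (suc i)) (suc (suc j)) e _ = cong (λ j → suc (suc j)) (punchIn-injective (skip x) i j (just-injective
      (trans (sym (special-label x _ _)) (trans (cong (Maybe.map label) e) (special-label x _ _)))))

  nb-symmetric : ∀ a p → Adjacent nb (nb a p) a
  nb-symmetric (t , x) p with v , y , st ← dart x p =
    subst (λ s → Adjacent nb (apply v t , y) (s , x)) (apply-inverse v t) (adjacent⁺ (apply v t) (step-reverse st))

  step-irreflexive : ∀ {x} → ¬ Step x nothing x
  step-irreflexive (up p) = shifted-≉ 1 z<s (≤-trans (s≤s (s≤s z≤n)) 4≤g) p
  step-irreflexive (down p) = shifted-≉ 1 z<s (≤-trans (s≤s (s≤s z≤n)) 4≤g) (sym p)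

  nb-irreflexive : ∀ a p → nb a p ≢ a
  nb-irreflexive (t , x) p e with dart x p
  ... | v , y , st with apply-injective {v} {nothing} (cong proj₁ e) | cong proj₂ e
  ... | refl | refl = step-irreflexive st

  -- Closed walks without backtracking

  -- Indexing by all natural numbers, with period `m`, lets a stretch run past the end of the walk
  -- and begin at any of its vertices.
  module Walk (t : ℕ → T) (x : ℕ → Fin g) (v : ℕ → Maybe Letter)
    (st : ∀ n → Step (x n) (v n) (x (suc n))) (t-step : ∀ n → apply (v n) (t n) ≡ t (suc n))
    (m : ℕ) (3≤m : 3 ≤ m) (m≤g : m ≤ g)
    (t-period : ∀ n → t (n + m) ≡ t n) (x-period : ∀ n → x (n + m) ≡ x n) (v-period : ∀ n → v (n + m) ≡ v n)
    (no-backtrack : ∀ n → ¬ (t (2 + n) ≡ t n × x (2 + n) ≡ x n)) where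

    X : ℕ → ℕ
    X n = toℕ (x n)

    Up Down : ℕ → Set
    Up n = suc (X n) ≈[ g ] X (suc n)
    Down n = X n ≈[ g ] suc (X (suc n))

    Silent : ℕ → ℕ → Set
    Silent p d = ∀ e → e < d → v (p + e) ≡ nothing

    silent-t : ∀ p d → Silent p d → t (p + d) ≡ t p
    silent-t p zero _ = cong t (+-identityʳ p)
    silent-t p (suc d) sil = begin
      t (p + suc d)              ≡⟨ cong t (+-suc p d) ⟩
      t (suc (p + d))            ≡⟨ t-step (p + d) ⟨
      apply (v (p + d)) (t (p + d))  ≡⟨ cong (λ u → apply u (t (p + d))) (sil d (n<1+n d)) ⟩
      t (p + d)                  ≡⟨ silent-t p d (λ e e<d → sil e (m<n⇒m<1+n e<d)) ⟩
      t p                        ∎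
      where open ≡-Reasoning

    record Cancelling (p len : ℕ) : Set where
      constructor cancelling
      field
        {i d}  : ℕ
        {a}    : Letter
        p≤i    : p ≤ i
        within : suc i + d < p + len
        first  : v i ≡ just a
        second : v (suc i + d) ≡ just (inv a)
        silent : Silent (suc i) d

    data LastLetter (p len : ℕ) : List Letter → Set where
      none : Silent p len → LastLetter p len []
      some : ∀ {a w} i d → p ≤ i → suc i + d ≡ p + len → v i ≡ just a → Silent (suc i) d → LastLetter p len (a ∷ w)

    -- The letters are pushed one by one onto a word, and `LastLetter` remembers when the top letter
    -- was read. A new letter either is inverse to the top one, which is the pair sought, or leaves
    -- the word reduced.
    scan : ∀ p len → Cancelling p len ⊎
      ∃ λ w → Reduced w × act* act w (t p) ≡ t (p + len) × length w ≤ len × LastLetter p len w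
    scan p zero = inj₂ ([] , [] , cong t (sym (+-identityʳ p)) , z≤n , none λ _ ())
    scan p (suc len) with scan p len
    ... | inj₁ (cancelling p≤i within first second silent) =
      inj₁ (cancelling p≤i (≤-trans within (+-monoʳ-≤ p (n≤1+n len))) first second silent)
    ... | inj₂ (w , red , acts , short , last) with v (p + len) in eq | t-step (p + len)
    ... | nothing | ts = inj₂ (w , red , trans acts (trans ts (cong t (sym (+-suc p len)))) , m≤n⇒m≤1+n short , extend last)
      where
      silent-extend : ∀ q d → q + d ≡ p + len → Silent q d → Silent q (suc d)
      silent-extend q d q+d sil e (s≤s e≤d) with m≤n⇒m<n∨m≡n e≤d
      ... | inj₁ e<d = sil e e<d
      ... | inj₂ refl = trans (cong v q+d) eq
      extend : ∀ {w} → LastLetter p len w → LastLetter p (suc len) w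
      extend (none sil) = none (silent-extend p len refl sil)
      extend (some i d p≤i end vi sil) =
        some i (suc d) p≤i (trans (+-suc (suc i) d) (trans (cong suc end) (sym (+-suc p len)))) vi (silent-extend (suc i) d end sil)
    ... | just c | ts = letter last red acts short
      where
      now : ∀ {w} → LastLetter p (suc len) (c ∷ w)
      now = some (p + len) 0 (m≤m+n p len) (trans (+-identityʳ _) (sym (+-suc p len))) eq λ _ ()
      acts′ : ∀ w → act* act w (t p) ≡ t (p + len) → act c (act* act w (t p)) ≡ t (p + suc len)
      acts′ _ e = trans (cong (act c) e) (trans ts (cong t (sym (+-suc p len))))
      letter : ∀ {w} → LastLetter p len w → Reduced w → act* act w (t p) ≡ t (p + len) → length w ≤ len → Cancelling p (suc len) ⊎
        ∃ λ w → Reduced w × act* act w (t p) ≡ t (p + suc len) × length w ≤ suc len × LastLetter p (suc len) w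
      letter (none sil) red acts short = inj₂ (c ∷ [] , [ c ] , acts′ [] acts , s≤s z≤n , now)
      letter {a ∷ w} (some i d p≤i end vi sil) red acts short with c ≟ᴸ inv a
      ... | yes refl = inj₁ (cancelling p≤i (≤-reflexive (trans (cong suc end) (sym (+-suc p len)))) vi (trans (cong v end) eq) sil)
      ... | no c≢ = inj₂ (c ∷ a ∷ w , c≢ ∷ red , acts′ (a ∷ w) acts , s≤s short , now)

    closed⇒cancelling : ∀ p len → len ≤ suc g → t (p + len) ≡ t p → Cancelling p len ⊎ Silent p len
    closed⇒cancelling p len len≤ closed with scan p len
    ... | inj₁ c = inj₁ c
    ... | inj₂ (.[] , _ , _ , _ , none sil) = inj₂ sil
    ... | inj₂ (w@(_ ∷ _) , red , acts , short , some _ _ _ _ _ _) =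
      contradiction (trans acts closed) (act-free w red z<s (≤-trans short len≤) (t p))

    silent-step : ∀ {n} → v n ≡ nothing → Up n ⊎ Down n
    silent-step {n} e with v n | st n
    silent-step refl | .nothing | up p = inj₁ p
    silent-step refl | .nothing | down p = inj₂ p

    -- Silent steps stay in one sheet, so a change of direction would return to the vertex two steps
    -- before.
    silent-monotone : ∀ p d → Silent p d → (∀ e → e < d → Up (p + e)) ⊎ (∀ e → e < d → Down (p + e))
    silent-monotone p zero _ = inj₁ λ _ ()
    silent-monotone p (suc zero) sil with silent-step (sil 0 z<s)
    ... | inj₁ u = inj₁ λ { zero _ → u ; (suc _) (s≤s ()) }
    ... | inj₂ w = inj₂ λ { zero _ → w ; (suc _) (s≤s ()) }
    silent-monotone p (suc (suc d)) sil with silent-monotone p (suc d) (λ e e<d → sil e (m<n⇒m<1+n e<d)) | silent-step (sil (suc d) (n<1+n _))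
    ... | inj₁ ups | inj₁ u = inj₁ λ e e<d → [ ups e , (λ { refl → u }) ]′ (m≤n⇒m<n∨m≡n (≤-pred e<d))
    ... | inj₂ downs | inj₂ w = inj₂ λ e e<d → [ downs e , (λ { refl → w }) ]′ (m≤n⇒m<n∨m≡n (≤-pred e<d))
    ... | inj₁ ups | inj₂ w = contradiction
      ( trans (cong t (trans (cong suc (sym (+-suc p d))) (sym (+-suc p (suc d))))) (trans (silent-t p (suc (suc d)) sil) (sym (silent-t p d λ e e<d → sil e (m<n⇒m<1+n (m<n⇒m<1+n e<d)))))
      , Fin-≈ (≈-cancelˡ 1 (trans (sym (subst Down (+-suc p d) w)) (sym (ups d (n<1+n d))))) )
      (no-backtrack (p + d))
    ... | inj₂ downs | inj₁ u = contradiction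
      ( trans (cong t (trans (cong suc (sym (+-suc p d))) (sym (+-suc p (suc d))))) (trans (silent-t p (suc (suc d)) sil) (sym (silent-t p d λ e e<d → sil e (m<n⇒m<1+n (m<n⇒m<1+n e<d)))))
      , Fin-≈ (trans (sym (subst Up (+-suc p d) u)) (sym (downs d (n<1+n d)))) )
      (no-backtrack (p + d))

    ups-total : ∀ p d → (∀ e → e < d → Up (p + e)) → X p + d ≈[ g ] X (p + d)
    ups-total p zero _ = cong (_% g) (trans (+-identityʳ (X p)) (cong X (sym (+-identityʳ p))))
    ups-total p (suc d) ups = begin
      (X p + suc d) % g       ≡⟨ cong (_% g) (+-suc (X p) d) ⟩
      suc (X p + d) % g       ≡⟨ ≈-+ {a = 1} refl (ups-total p d (λ e e<d → ups e (m<n⇒m<1+n e<d))) ⟩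
      suc (X (p + d)) % g     ≡⟨ ups d (n<1+n d) ⟩
      X (suc (p + d)) % g     ≡⟨ cong (λ n → X n % g) (+-suc p d) ⟨
      X (p + suc d) % g       ∎
      where open ≡-Reasoning

    downs-total : ∀ p d → (∀ e → e < d → Down (p + e)) → X p ≈[ g ] X (p + d) + d
    downs-total p zero _ = cong (_% g) (trans (cong X (sym (+-identityʳ p))) (sym (+-identityʳ _)))
    downs-total p (suc d) downs = begin
      X p % g                      ≡⟨ downs-total p d (λ e e<d → downs e (m<n⇒m<1+n e<d)) ⟩
      (X (p + d) + d) % g          ≡⟨ ≈-+ {c = d} (downs d (n<1+n d)) refl ⟩
      (suc (X (suc (p + d))) + d) % g  ≡⟨ cong (λ n → (suc (X n) + d) % g) (+-suc p d) ⟨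
      (suc (X (p + suc d)) + d) % g    ≡⟨ cong (_% g) (+-suc (X (p + suc d)) d) ⟨
      (X (p + suc d) + suc d) % g  ∎
      where open ≡-Reasoning

    -- The two ways around ℤ/g from one edge of a cut to the other.
    near-way : ∀ s {b d} → suc d < g → suc (edge s b) + d ≈[ g ] edge (not s) b → suc d ≡ δ s
    near-way s {b} {d} d<g e = ≈-small d<g (≤-trans (n≤1+n _) (2+δ≤g s)) (≈-cancelˡ (edge s b)
      (trans (cong (_% g) (+-suc (edge s b) d)) (trans e (sym (edge+δ s b)))))

    far-way : ∀ s {b d} → suc d < g → suc (edge s b) ≈[ g ] edge (not s) b + d → d ≡ suc (δ (not s))
    far-way s {b} {d} d<g e = +-cancelˡ-≡ (δ s) d (suc (δ (not s))) (trans
      -- Both `δ s` and `d` are below `g`, so their sum, being congruent to 1 and greater than 1, is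
      -- 1 + `g`.
      (≈-wrap {a = 1} (≤-trans (s≤s (s≤s z≤n)) 4≤g) (≤-trans (2≤δ s) (m≤m+n _ d)) (+-mono-< (≤-trans (n≤1+n _) (2+δ≤g s)) (<-trans (n<1+n d) d<g))
        (≈-cancelˡ (edge s b) (begin
          (edge s b + 1) % g             ≡⟨ cong (_% g) (+-comm (edge s b) 1) ⟩
          suc (edge s b) % g             ≡⟨ e ⟩
          (edge (not s) b + d) % g       ≡⟨ ≈-+ {c = d} (edge+δ s b) refl ⟨
          (edge s b + δ s + d) % g       ≡⟨ cong (_% g) (+-assoc (edge s b) (δ s) d) ⟩
          (edge s b + (δ s + d)) % g     ∎)))
      (trans (cong suc (sym (δ+δ s))) (sym (+-suc (δ s) (δ (not s))))))
      where open ≡-Reasoning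

    upward : ∀ s ℓ p d → Silent p d → suc d < g → suc (edge s (pos ℓ)) ≈[ g ] X p → X (p + d) ≡ edge (not s) (pos ℓ) →
      ((∀ e → e < d → Up (p + e)) × suc d ≡ δ s) ⊎ d ≡ suc (δ (not s))
    upward s ℓ p d sil d<g start end with silent-monotone p d sil
    ... | inj₁ ups = inj₁ (ups , near-way s d<g (trans (≈-+ {c = d} start refl) (trans (ups-total p d ups) (cong (_% g) end))))
    ... | inj₂ downs = inj₂ (far-way s d<g (trans start (trans (downs-total p d downs) (cong (λ n → (n + d) % g) end))))

    downward : ∀ s ℓ p d → Silent p d → suc d < g → X p ≡ edge (not s) (pos ℓ) → X (p + d) ≈[ g ] suc (edge s (pos ℓ)) →
      ((∀ e → e < d → Down (p + e)) × suc d ≡ δ s) ⊎ d ≡ suc (δ (not s))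
    downward s ℓ p d sil d<g start end with silent-monotone p d sil
    ... | inj₁ ups = inj₂ (far-way s d<g (trans (sym end) (trans (sym (ups-total p d ups)) (cong (λ n → (n + d) % g) start))))
    ... | inj₂ downs = inj₁ (downs , near-way s d<g (trans (≈-+ {c = d} (sym end) refl) (trans (sym (downs-total p d downs)) (cong (_% g) start))))

    silent-return : ∀ p d → Silent p d → d < g → X p ≈[ g ] X (p + d) → d ≡ 0
    silent-return p d sil d<g e with silent-monotone p d sil
    ... | inj₁ ups = ≈-small d<g (≤-<-trans z≤n d<g) (≈-cancelˡ (X p) (trans (ups-total p d ups) (trans (sym e) (cong (_% g) (sym (+-identityʳ (X p)))))))
    ... | inj₂ downs = ≈-small d<g (≤-<-trans z≤n d<g) (≈-cancelˡ (X (p + d)) (trans (sym (downs-total p d downs)) (trans e (cong (_% g) (sym (+-identityʳ (X (p + d))))))))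

    cancel-t : ∀ {i d a} → v i ≡ just a → v (suc i + d) ≡ just (inv a) → Silent (suc i) d → t (suc (suc i + d)) ≡ t i
    cancel-t {i} {d} {a} first second sil = begin
      t (suc (suc i + d))                     ≡⟨ t-step (suc i + d) ⟨
      apply (v (suc i + d)) (t (suc i + d))   ≡⟨ cong₂ apply second (silent-t (suc i) d sil) ⟩
      act (inv a) (t (suc i))                 ≡⟨ cong (act (inv a)) (t-step i) ⟨
      act (inv a) (apply (v i) (t i))         ≡⟨ cong (λ u → act (inv a) (apply u (t i))) first ⟩
      act (inv a) (act a (t i))               ≡⟨ act-inv a (t i) ⟩
      t i                                     ∎
      where open ≡-Reasoning

    record UpPair (i d : ℕ) : Set where
      field
        s : Bool
        ℓ : Label
        at-i : X i ≡ edge s (pos ℓ)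
        at-j : X (suc i + d) ≡ edge (not s) (pos ℓ)
        up-i : Up i
        up-j : Up (suc i + d)
        way : ((∀ e → e < d → Up (suc i + e)) × suc d ≡ δ s) ⊎ d ≡ suc (δ (not s))

    record DownPair (i d : ℕ) : Set where
      field
        s : Bool
        ℓ : Label
        at-i : X (suc i) ≡ edge (not s) (pos ℓ)
        at-j : X (suc (suc i + d)) ≡ edge s (pos ℓ)
        down-i : Down i
        down-j : Down (suc i + d)
        way : ((∀ e → e < d → Down (suc i + e)) × suc d ≡ δ s) ⊎ d ≡ suc (δ (not s))

    backtracks : ∀ {i d a} → v i ≡ just a → v (suc i + d) ≡ just (inv a) → Silent (suc i) d → suc d < g →
      X (suc i) ≈[ g ] X (suc i + d) → X (suc (suc i + d)) ≈[ g ] X i → ⊥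
    backtracks {i} {d} first second sil d<g back home with refl ← silent-return (suc i) d sil (<-trans (n<1+n d) d<g) back =
      no-backtrack i
        ( trans (cong (t ∘ suc) (sym (+-identityʳ (suc i)))) (cancel-t first second sil)
        , trans (cong (x ∘ suc) (sym (+-identityʳ (suc i)))) (Fin-≈ home))

    -- Inverse letters belong to one cut, or are the same `ρ` over the same position. If the second
    -- step reverses the first, the silent stretch between them begins and ends at one position,
    -- hence is empty, and the walk backtracks. What remains is the two different edges of a cut,
    -- passed in the same direction.
    classify : ∀ {i d a} → v i ≡ just a → v (suc i + d) ≡ just (inv a) → Silent (suc i) d → suc d < g → UpPair i d ⊎ DownPair i d
    classify {i} {d} {a} first second sil d<g = go (subst (λ u → Step (x i) u (x (suc i))) first (st i))
      (subst (λ u → Step (x (suc i + d)) u (x (suc (suc i + d)))) second (st (suc i + d))) refl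
      where
      bt : X (suc i) ≈[ g ] X (suc i + d) → X (suc (suc i + d)) ≈[ g ] X i → UpPair i d ⊎ DownPair i d
      bt p q = ⊥-elim (backtracks first second sil d<g p q)
      go : ∀ {u u′} → Step (x i) (just u) (x (suc i)) → Step (x (suc i + d)) (just u′) (x (suc (suc i + d))) → u′ ≡ inv u → UpPair i d ⊎ DownPair i d
      go (cutUp s ℓ _ e p) (cutUp _ _ _ e′ p′) refl = inj₁ record
        { s = s ; ℓ = ℓ ; at-i = e ; at-j = e′ ; up-i = p ; up-j = p′
        ; way = upward s ℓ (suc i) d sil d<g (trans (cong (λ n → suc n % g) (sym e)) p) e′ }
      go (cutUp s ℓ _ e p) (cutDown s′ _ _ e′ p′) eq with σ-injective eq
      ... | q , refl with refl ← not-injective q = bt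
        (trans (sym p) (trans (cong (λ n → suc n % g) (trans e (sym e′))) (sym p′))) (cong (_% g) (trans e′ (sym e)))
      go (cutDown s ℓ _ e p) (cutUp s′ _ _ e′ p′) eq with σ-injective eq
      ... | q , refl with refl ← trans q (not-involutive s) = bt
        (cong (_% g) (trans e (sym e′))) (trans (sym p′) (trans (cong (λ n → suc n % g) (trans e′ (sym e))) (sym p)))
      go (cutDown s ℓ _ e p) (cutDown s′ _ _ e′ p′) eq with σ-injective eq
      ... | q , refl with refl ← not-injective q = inj₂ record
        { s = not s ; ℓ = ℓ ; at-i = start ; at-j = e′ ; down-i = p ; down-j = p′
        ; way = downward (not s) ℓ (suc i) d sil d<g start (trans p′ (cong (λ n → suc n % g) e′)) }
        where
        start : X (suc i) ≡ edge (not (not s)) (pos ℓ)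
        start = trans e (cong (λ z → edge z (pos ℓ)) (sym (not-involutive s)))
      go (loop ℓ e _ _) (loop ℓ′ e′ _ _) eq = bt (cong (λ y → toℕ y % g) (trans e (sym (ρ-injective eq)))) (cong (λ y → toℕ y % g) (trans e′ (ρ-injective eq)))
      go (loop _ _ _ _) (cutUp _ _ _ _ _) ()
      go (loop _ _ _ _) (cutDown _ _ _ _ _) ()
      go (cutUp _ _ _ _ _) (loop _ _ _ _) ()
      go (cutDown _ _ _ _ _) (loop _ _ _ _) ()

    way-long : ∀ s {d} {P : Set} → (P × suc d ≡ δ s) ⊎ d ≡ suc (δ (not s)) → h ≤ suc d
    way-long s (inj₁ (_ , e)) = ≤-trans (h≤δ s) (≤-reflexive (sym e))
    way-long s (inj₂ e) = ≤-trans (h≤δ (not s)) (≤-trans (n≤1+n _) (≤-trans (≤-reflexive (sym e)) (n≤1+n _)))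

    -- A silent part going the long way round would make the walk longer than g.
    ways : ∀ s {d d′} {P P′ : Set} → (P × suc d ≡ δ s) ⊎ d ≡ suc (δ (not s)) → (P′ × suc d′ ≡ δ (not s)) ⊎ d′ ≡ suc (δ (not (not s))) →
      suc d + suc d′ ≤ g → P × P′
    ways s (inj₁ (p , _)) (inj₁ (p′ , _)) _ = p , p′
    ways s {d} {d′} w (inj₂ e) le = contradiction le (<⇒≱ (begin-strict
      g                           ≤⟨ g≤1+2h ⟩
      suc (h + h)                 <⟨ n<1+n _ ⟩
      suc (suc (h + h))           ≡⟨ cong suc (+-suc h h) ⟨
      suc (h + suc h)             ≡⟨ +-suc h (suc h) ⟨
      h + suc (suc h)             ≤⟨ +-mono-≤ (way-long s w) (s≤s (s≤s (h≤δ (not (not s))))) ⟩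
      suc d + suc (suc (δ (not (not s))))  ≡⟨ cong (λ n → suc d + suc n) e ⟨
      suc d + suc d′              ∎))
      where open ≤-Reasoning
    ways s {d} {d′} (inj₂ e) (inj₁ w) le = contradiction le (<⇒≱ (begin-strict
      g                           ≤⟨ g≤1+2h ⟩
      suc (h + h)                 <⟨ n<1+n _ ⟩
      suc (suc h) + h             ≤⟨ +-mono-≤ (s≤s (s≤s (h≤δ (not s)))) (way-long (not s) (inj₁ w)) ⟩
      suc (suc (δ (not s))) + suc d′  ≡⟨ cong (λ n → suc n + suc d′) e ⟨
      suc d + suc d′              ∎))
      where open ≤-Reasoning

    -- Counts the room that a pair needs: at least `h` + 1 steps, both letters included.
    cancelling-long : ∀ {p len} → len ≤ m → (c : Cancelling p len) → h ≤ suc (Cancelling.d c) × suc (suc (Cancelling.d c)) ≤ len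
    cancelling-long {p} {len} len≤m (cancelling {i} {d} p≤i within first second silent) =
      [ (λ u → way-long (UpPair.s u) (UpPair.way u)) , (λ u → way-long (DownPair.s u) (DownPair.way u)) ]′
        (classify first second silent (≤-trans d+2≤len (≤-trans len≤m m≤g))) , d+2≤len
      where
      d+2≤len : suc (suc d) ≤ len
      d+2≤len = +-cancelˡ-≤ p _ _ (≤-trans (≤-trans (+-monoˡ-≤ (suc (suc d)) p≤i) (≤-reflexive (trans (+-suc i (suc d)) (cong suc (+-suc i d))))) within)

    record Outcome : Set where
      field
        monotone : (∀ n → n < m → Up n) ⊎ (∀ n → n < m → Down n)
        letters  : Silent 0 m ⊎ ∃ λ i → ∃ λ j → ∃ λ a → i < j × j < m × v i ≡ just a × v j ≡ just (inv a) ×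
                     (∀ n → n < m → n ≢ i → n ≢ j → v n ≡ nothing)

    -- Since the pair at `i` and `j` cancels, the complementary stretch, from `suc j` around to
    -- `i + m`, is closed in T as well. A second pair inside it would bring the length to at least
    -- 2h + 2 > `g`, so it is silent. By `ways` neither stretch goes the long way round, hence both
    -- continue in the direction of the pair.
    outcome : Outcome
    outcome with closed⇒cancelling 0 m (m≤n⇒m≤1+n m≤g) (t-period 0)
    ... | inj₂ sil = record { monotone = silent-monotone 0 m sil ; letters = inj₁ sil }
    ... | inj₁ c@(cancelling {i} {d} {a} z≤n j<m first second silent) = record
      { monotone = monotone
      ; letters = inj₂ (i , j , a , s≤s (m≤m+n i d) , j<m , first , second , elsewhere)
      }
      where
      j = suc i + d
      d′ = m ∸ suc (suc d)
      d+2≤m : suc (suc d) ≤ m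
      d+2≤m = proj₂ (cancelling-long ≤-refl c)
      d+d′ : suc (suc d) + d′ ≡ m
      d+d′ = m+[n∸m]≡n d+2≤m
      wrap : suc j + d′ ≡ i + m
      wrap = begin
        suc (suc i + d) + d′      ≡⟨ cong (λ n → suc (suc n) + d′) (+-comm i d) ⟩
        suc (suc d) + i + d′      ≡⟨ cong (_+ d′) (+-comm (suc (suc d)) i) ⟩
        i + suc (suc d) + d′      ≡⟨ +-assoc i (suc (suc d)) d′ ⟩
        i + (suc (suc d) + d′)    ≡⟨ cong (i +_) d+d′ ⟩
        i + m                     ∎
        where open ≡-Reasoning
      closed′ : t (suc j + d′) ≡ t (suc j)
      closed′ = trans (cong t wrap) (trans (t-period i) (sym (cancel-t first second silent)))
      silent′ : Silent (suc j) d′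
      silent′ with closed⇒cancelling (suc j) d′ (≤-trans (m∸n≤m m (suc (suc d))) (m≤n⇒m≤1+n m≤g)) closed′
      ... | inj₂ sil = sil
      ... | inj₁ c′ with h≤ , fits ← cancelling-long (m∸n≤m m (suc (suc d))) c′ = contradiction m≤g (<⇒≱ (begin-strict
        g                        ≤⟨ g≤1+2h ⟩
        suc (h + h)              <⟨ n<1+n _ ⟩
        suc (suc (h + h))        ≡⟨ cong suc (+-suc h h) ⟨
        suc h + suc h            ≤⟨ +-mono-≤ (s≤s (proj₁ (cancelling-long ≤-refl c))) (≤-trans (s≤s h≤) fits) ⟩
        suc (suc d) + d′         ≡⟨ d+d′ ⟩
        m                        ∎))
        where open ≤-Reasoning
      -- Times n < m outside [i, j], counted from suc j around the cycle
      later : ∀ {n} → n < m → n < i ⊎ j < n → ∃ λ e → e < d′ × (suc j + e ≡ n ⊎ suc j + e ≡ n + m)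
      later {n} n<m (inj₂ j<n) = n ∸ suc j , +-cancelˡ-< (suc j) _ _ (begin-strict
          suc j + (n ∸ suc j)   ≡⟨ m+[n∸m]≡n j<n ⟩
          n                     <⟨ n<m ⟩
          m                     ≤⟨ m≤n+m m i ⟩
          i + m                 ≡⟨ wrap ⟨
          suc j + d′            ∎) , inj₁ (m+[n∸m]≡n j<n)
        where open ≤-Reasoning
      later {n} n<m (inj₁ n<i) = n + m ∸ suc j , +-cancelˡ-< (suc j) _ _ (begin-strict
          suc j + (n + m ∸ suc j)   ≡⟨ m+[n∸m]≡n j<n+m ⟩
          n + m                     <⟨ +-monoˡ-< m n<i ⟩
          i + m                     ≡⟨ wrap ⟨
          suc j + d′                ∎) , inj₂ (m+[n∸m]≡n j<n+m)
        where
        open ≤-Reasoning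
        j<n+m : suc j ≤ n + m
        j<n+m = ≤-trans j<m (m≤n+m m n)
      place : ∀ n → n < m → n ≡ i ⊎ n ≡ j ⊎ (∃ λ e → e < d × suc i + e ≡ n) ⊎ (∃ λ e → e < d′ × (suc j + e ≡ n ⊎ suc j + e ≡ n + m))
      place n n<m with <-cmp n i | <-cmp n j
      ... | tri≈ _ n≡i _ | _ = inj₁ n≡i
      ... | tri< n<i _ _ | _ = inj₂ (inj₂ (inj₂ (later n<m (inj₁ n<i))))
      ... | tri> _ _ i<n | tri≈ _ n≡j _ = inj₂ (inj₁ n≡j)
      ... | tri> _ _ i<n | tri< n<j _ _ = inj₂ (inj₂ (inj₁ (n ∸ suc i , +-cancelˡ-< (suc i) _ _ (subst (_< j) (sym (m+[n∸m]≡n i<n)) n<j) , m+[n∸m]≡n i<n)))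
      ... | tri> _ _ i<n | tri> _ _ j<n = inj₂ (inj₂ (inj₂ (later n<m (inj₂ j<n))))
      elsewhere : ∀ n → n < m → n ≢ i → n ≢ j → v n ≡ nothing
      elsewhere n n<m n≢i n≢j with place n n<m
      ... | inj₁ n≡i = contradiction n≡i n≢i
      ... | inj₂ (inj₁ n≡j) = contradiction n≡j n≢j
      ... | inj₂ (inj₂ (inj₁ (e , e< , eq))) = trans (cong v (sym eq)) (silent e e<)
      ... | inj₂ (inj₂ (inj₂ (e , e< , inj₁ eq))) = trans (cong v (sym eq)) (silent′ e e<)
      ... | inj₂ (inj₂ (inj₂ (e , e< , inj₂ eq))) = trans (sym (v-period n)) (trans (cong v (sym eq)) (silent′ e e<))
      everywhere : (P : ℕ → Set) → (∀ n → P (n + m) → P n) → P i → P j → (∀ e → e < d → P (suc i + e)) → (∀ e → e < d′ → P (suc j + e)) →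
        ∀ n → n < m → P n
      everywhere P period Pi Pj Pd Pd′ n n<m with place n n<m
      ... | inj₁ n≡i = subst P (sym n≡i) Pi
      ... | inj₂ (inj₁ n≡j) = subst P (sym n≡j) Pj
      ... | inj₂ (inj₂ (inj₁ (e , e< , eq))) = subst P eq (Pd e e<)
      ... | inj₂ (inj₂ (inj₂ (e , e< , inj₁ eq))) = subst P eq (Pd′ e e<)
      ... | inj₂ (inj₂ (inj₂ (e , e< , inj₂ eq))) = period n (subst P eq (Pd′ e e<))
      x-wrap : x (suc j + d′) ≡ x i
      x-wrap = trans (cong x wrap) (x-period i)
      d+d′≤g : suc d + suc d′ ≤ g
      d+d′≤g = ≤-trans (≤-reflexive (trans (+-suc (suc d) d′) d+d′)) m≤g
      d′<g : suc d′ < g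
      d′<g = ≤-trans (s≤s (m≤n+m (suc d′) d)) d+d′≤g
      monotone : (∀ n → n < m → Up n) ⊎ (∀ n → n < m → Down n)
      monotone with classify first second silent (≤-trans d+2≤m m≤g)
      ... | inj₁ u = inj₁ (everywhere Up
          (λ n → subst₂ (λ y z → suc (toℕ y) ≈[ g ] toℕ z) (x-period n) (x-period (suc n))) up-i up-j (proj₁ both) (proj₂ both))
        where
        open UpPair u
        both = ways s way (upward (not s) ℓ (suc j) d′ silent′ d′<g (trans (cong (λ n → suc n % g) (sym at-j)) up-j)
          (trans (cong toℕ x-wrap) (trans at-i (cong (λ z → edge z (pos ℓ)) (sym (not-involutive s)))))) d+d′≤g
      ... | inj₂ u = inj₂ (everywhere Down
          (λ n → subst₂ (λ y z → toℕ y ≈[ g ] suc (toℕ z)) (x-period n) (x-period (suc n))) down-i down-j (proj₁ both) (proj₂ both))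
        where
        open DownPair u
        both = ways s way (downward (not s) ℓ (suc j) d′ silent′ d′<g (trans at-j (cong (λ z → edge z (pos ℓ)) (sym (not-involutive s))))
          (trans (cong (λ y → toℕ y % g) x-wrap) (trans down-i (cong (λ n → suc n % g) at-i)))) d+d′≤g

  module CycleWalk {m : ℕ} .{{_ : NonZero m}} (3≤m : 3 ≤ m) (m≤g : m ≤ g) (f : Fin m → Vertex) (cy : Cycle nb m f) where

    F : ℕ → Vertex
    F n = f (n mod m)

    private
      link : ∀ n → ∃ λ v → Step (proj₂ (F n)) v (proj₂ (F (suc n))) × apply v (proj₁ (F n)) ≡ proj₁ (F (suc n))
      link n = adjacent⁻ (proj₂ cy _ _ (mod-consecutive n m))

      F-period : ∀ n → F (n + m) ≡ F n
      F-period n = cong f (mod-cong m (≈-+g n))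

      v-period : ∀ n → proj₁ (link (n + m)) ≡ proj₁ (link n)
      v-period n = apply-injective {t = proj₁ (F n)} (begin
        apply (proj₁ (link (n + m))) (proj₁ (F n))         ≡⟨ cong (λ z → apply (proj₁ (link (n + m))) (proj₁ z)) (F-period n) ⟨
        apply (proj₁ (link (n + m))) (proj₁ (F (n + m)))   ≡⟨ proj₂ (proj₂ (link (n + m))) ⟩
        proj₁ (F (suc (n + m)))                            ≡⟨ cong proj₁ (F-period (suc n)) ⟩
        proj₁ (F (suc n))                                  ≡⟨ proj₂ (proj₂ (link n)) ⟨
        apply (proj₁ (link n)) (proj₁ (F n))               ∎)
        where open ≡-Reasoning

      no-backtrack : ∀ n → ¬ (proj₁ (F (2 + n)) ≡ proj₁ (F n) × proj₂ (F (2 + n)) ≡ proj₂ (F n))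
      no-backtrack n (p , q) = 1+n≢0 (≈-small 3≤m (≤-trans (s≤s z≤n) 3≤m) (≈-cancelʳ n {2} {0}
        (trans (sym (toℕ-mod (2 + n) m)) (trans (cong toℕ (proj₁ cy _ _ (cong₂ _,_ p q))) (toℕ-mod n m)))))

    open Walk (proj₁ ∘ F) (proj₂ ∘ F) (λ n → proj₁ (link n)) (λ n → proj₁ (proj₂ (link n))) (λ n → proj₂ (proj₂ (link n)))
      m 3≤m m≤g (λ n → cong proj₁ (F-period n)) (λ n → cong proj₂ (F-period n)) v-period no-backtrack public

    letter : ℕ → Maybe Letter
    letter n = proj₁ (link n)

    letter-step : ∀ n → Step (proj₂ (F n)) (letter n) (proj₂ (F (suc n)))
    letter-step n = proj₁ (proj₂ (link n))

    letter-acts : ∀ n → apply (letter n) (proj₁ (F n)) ≡ proj₁ (F (suc n))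
    letter-acts n = proj₂ (proj₂ (link n))

    -- A monotone walk of `m` steps moves by `m` in ℤ/g, and it returns to its start.
    m≡g : m ≡ g
    m≡g = ≈0⇒≡g (≤-trans (s≤s z≤n) 3≤m) m≤g (≈-cancelˡ (X 0) (trans
      ([ (λ ups → trans (ups-total 0 m ups) (cong (λ y → toℕ (proj₂ y) % g) (F-period 0)))
       , (λ downs → trans (cong (λ y → (toℕ (proj₂ y) + m) % g) (sym (F-period 0))) (sym (downs-total 0 m downs))) ]′ (Outcome.monotone outcome))
      (cong (_% g) (sym (+-identityʳ (X 0))))))

    Rising Falling : Set
    Rising = ∀ i j → Consecutive m i j → suc (toℕ (proj₂ (f i))) ≈[ g ] toℕ (proj₂ (f j))
    Falling = ∀ i j → Consecutive m i j → toℕ (proj₂ (f i)) ≈[ g ] suc (toℕ (proj₂ (f j)))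

    private
      F-toℕ : ∀ i → F (toℕ i) ≡ f i
      F-toℕ i = cong f (toℕ-mod-id i)

      F-suc : ∀ {i j} → Consecutive m i j → F (suc (toℕ i)) ≡ f j
      F-suc c = cong f (sym (consecutive⇒mod c))

    rising⊎falling : Rising ⊎ Falling
    rising⊎falling with Outcome.monotone outcome
    ... | inj₁ ups = inj₁ λ i j c → subst₂ (λ a b → suc (toℕ (proj₂ a)) ≈[ g ] toℕ (proj₂ b)) (F-toℕ i) (F-suc c) (ups (toℕ i) (toℕ<n i))
    ... | inj₂ downs = inj₂ λ i j c → subst₂ (λ a b → toℕ (proj₂ a) ≈[ g ] suc (toℕ (proj₂ b))) (F-toℕ i) (F-suc c) (downs (toℕ i) (toℕ<n i))

  -- The girth cycles of the cut graph

  reverse-cycle : ∀ {m f} → Cycle nb m f → Cycle nb m (f ∘ opposite)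
  reverse-cycle {f = f} (inj , adj) =
    (λ i j e → trans (sym (opposite-involutive i)) (trans (cong opposite (inj _ _ e)) (opposite-involutive j))) ,
    λ i j c → back (adj _ _ (opposite-consecutive c))
    where
    back : ∀ {a b} → Adjacent nb a b → Adjacent nb b a
    back {a} (p , refl) = nb-symmetric a p

  -- Because `pos ℓ + h < g`, the arc between the two edges of a cut does not wrap around, so a
  -- plain interval describes it.
  Between : Label → Fin g → Set
  Between ℓ y = pos ℓ < toℕ y × toℕ y ≤ pos ℓ + h

  between? : ∀ ℓ y → Dec (Between ℓ y)
  between? ℓ y = (pos ℓ <? toℕ y) ×-dec (toℕ y ≤? pos ℓ + h)

  actIf : ∀ {P : Set} → Dec P → Letter → T → T
  actIf (yes _) a t = act a t
  actIf (no _) a t = t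

  actIf-inv : ∀ {P : Set} (P? : Dec P) a t → actIf P? (inv a) (actIf P? a t) ≡ t
  actIf-inv (yes _) a t = act-inv a t
  actIf-inv (no _) a t = refl

  actIf-yes : ∀ {P : Set} (P? : Dec P) {a t} → P → actIf P? a t ≡ act a t
  actIf-yes (yes _) _ = refl
  actIf-yes (no ¬p) p = contradiction p ¬p

  actIf-no : ∀ {P : Set} (P? : Dec P) {a t} → ¬ P → actIf P? a t ≡ t
  actIf-no (yes p) ¬p = contradiction p ¬p
  actIf-no (no _) _ = refl

  bent : T → Label → Fin g → T
  bent t ℓ y = actIf (between? ℓ y) (σ true ℓ) t

  bent-step : ∀ t ℓ → toℕ ℓ < cuts → ∀ y y′ → Consecutive g y y′ →
    ∃ λ v → Step y v y′ × apply v (bent t ℓ y) ≡ bent t ℓ y′ × (v ≡ nothing ⊎ ∃ λ s → v ≡ just (σ s ℓ))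
  bent-step t ℓ c y y′ con with between? ℓ y | between? ℓ y′
  ... | yes _ | yes _ = nothing , up (consecutive⇒≈ con) , refl , inj₁ refl
  ... | no _ | no _ = nothing , up (consecutive⇒≈ con) , refl , inj₁ refl
  ... | no ¬in | yes (lo , hi) = just (σ true ℓ) , cutUp true ℓ c (entry con) (consecutive⇒≈ con) , refl , inj₂ (true , refl)
    where
    entry : Consecutive g y y′ → toℕ y ≡ pos ℓ
    entry (inj₂ (_ , y′≡0)) = contradiction (subst (pos ℓ <_) y′≡0 lo) λ ()
    entry (inj₁ e) = ≤-antisym (≮⇒≥ λ lo′ → ¬in (lo′ , ≤-trans (n≤1+n _) (≤-trans (≤-reflexive e) hi)))
      (≤-pred (≤-trans lo (≤-reflexive (sym e))))
  ... | yes (lo , hi) | no ¬in = just (σ false ℓ) , cutUp false ℓ c (exit con) (consecutive⇒≈ con) , act-inv (σ true ℓ) t , inj₂ (false , refl)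
    where
    exit : Consecutive g y y′ → toℕ y ≡ pos ℓ + h
    exit (inj₁ e) = ≤-antisym hi (≮⇒≥ λ hi′ → ¬in (≤-trans lo (≤-trans (n≤1+n _) (≤-reflexive e)) , ≤-trans (≤-reflexive (sym e)) hi′))
    exit (inj₂ (e , _)) = ≤-antisym hi (≤-pred (≤-trans (pos< ℓ) (≤-reflexive (sym e))))

  cutLabel : Fin cuts → Label
  cutLabel c = inject≤ c cuts≤

  cutLabel< : ∀ c → toℕ (cutLabel c) < cuts
  cutLabel< c = subst (_< cuts) (sym (toℕ-inject≤ c cuts≤)) (toℕ<n c)

  cutLabel-injective : ∀ {c c′} → cutLabel c ≡ cutLabel c′ → c ≡ c′
  cutLabel-injective = inject≤-injective cuts≤ cuts≤ _ _

  cutLabel-onto : ∀ {ℓ} → toℕ ℓ < cuts → ∃ λ c → cutLabel c ≡ ℓ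
  cutLabel-onto {ℓ} ℓ<cuts = fromℕ< ℓ<cuts , toℕ-injective (trans (toℕ-inject≤ _ cuts≤) (toℕ-fromℕ< ℓ<cuts))

  -- If `x` lies on the arc between the edges of the cut, `t` is first taken back to the outer
  -- sheet, so that the bent cycle passes through `(t , x)` itself.
  height : Vertex → Fin (suc cuts) → Fin g → T
  height (t , x) zero y = t
  height (t , x) (suc c) y = bent (actIf (between? (cutLabel c) x) (σ false (cutLabel c)) t) (cutLabel c) y

  cell : Vertex → Fin (suc cuts) → Fin g → Vertex
  cell a c y = height a c y , y

  cell-cycle : ∀ a c → Cycle nb g (cell a c)
  cell-cycle a c = (λ i j e → cong proj₂ e) , λ y y′ con → adj c y y′ con
    where
    adj : ∀ c y y′ → Consecutive g y y′ → Adjacent nb (cell a c y) (cell a c y′)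
    adj zero y y′ con = adjacent⁺ _ (up (consecutive⇒≈ con))
    adj (suc c) y y′ con with v , s , e , _ ← bent-step (actIf (between? (cutLabel c) (proj₂ a)) (σ false (cutLabel c)) (proj₁ a)) (cutLabel c) (cutLabel< c) y y′ con =
      subst (λ u → Adjacent nb (cell a (suc c) y) (u , y′)) e (adjacent⁺ _ s)

  height-self : ∀ t x c → height (t , x) c x ≡ t
  height-self t x zero = refl
  height-self t x (suc c) = actIf-inv (between? (cutLabel c) x) (σ false (cutLabel c)) t

  section-⊑ : ∀ {τ τ′ : Fin g → T} → (λ y → τ y , y) ⊑ (λ y → τ′ y , y) → ∀ y → τ y ≡ τ′ y
  section-⊑ {τ} {τ′} sub y with onCycle⁻ (sub _ _ (edgeOf-next (λ y → τ y , y) y))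
  ... | i , e with refl ← cong proj₂ e = sym (cong proj₁ e)

  bent-turn : ∀ t ℓ → ∃ λ y → ∃ λ y′ → Consecutive g y y′ × act (σ true ℓ) (bent t ℓ y) ≡ bent t ℓ y′
  bent-turn t ℓ = fromℕ< b<g , fromℕ< sb<g , inj₁ (trans (cong suc (toℕ-fromℕ< b<g)) (sym (toℕ-fromℕ< sb<g))) ,
    trans (cong (act (σ true ℓ)) (actIf-no (between? ℓ _) λ (lo , _) → <-irrefl (sym (toℕ-fromℕ< b<g)) lo))
      (sym (actIf-yes (between? ℓ _) (≤-reflexive (sym (toℕ-fromℕ< sb<g)) , ≤-trans (≤-reflexive (toℕ-fromℕ< sb<g)) (pos<pos+h ℓ))))
    where
    b<g = ≤-trans (pos<pos+h ℓ) (<⇒≤ (pos< ℓ))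
    sb<g = ≤-<-trans (pos<pos+h ℓ) (pos< ℓ)

  -- Cells are sections over ℤ/g, so containment of edges forces equal heights. Then the letter at
  -- the place where a bent cell changes sheets gives away its cut.
  cell-separated : ∀ a c c′ → cell a c ⊑ cell a c′ → c ≡ c′
  cell-separated a c c′ sub = go c c′ (section-⊑ {height a c} {height a c′} sub)
    where
    base : Fin cuts → T
    base c = actIf (between? (cutLabel c) (proj₂ a)) (σ false (cutLabel c)) (proj₁ a)
    go : ∀ c c′ → (∀ y → height a c y ≡ height a c′ y) → c ≡ c′
    go zero zero _ = refl
    go zero (suc c) same with y , y′ , _ , turn ← bent-turn (base c) (cutLabel c) =
      contradiction (trans turn (trans (sym (same y′)) (same y))) (act-moves _ _)
    go (suc c) zero same with y , y′ , _ , turn ← bent-turn (base c) (cutLabel c) =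
      contradiction (trans turn (trans (same y′) (sym (same y)))) (act-moves _ _)
    go (suc c) (suc c′) same with bent-turn (base c) (cutLabel c)
    ... | y , y′ , con , turn with bent-step (base c′) (cutLabel c′) (cutLabel< c′) y y′ con
    ... | v , _ , e , letter = cong suc (cutLabel-injective (sameLabel letter
        (apply-injective {v} {just (σ true (cutLabel c))} (trans e (trans (sym (same y′)) (trans (sym turn) (cong (act (σ true (cutLabel c))) (same y))))))))
      where
      sameLabel : ∀ {v ℓ ℓ′} → v ≡ nothing ⊎ (∃ λ s → v ≡ just (σ s ℓ′)) → v ≡ just (σ true ℓ) → ℓ ≡ ℓ′
      sameLabel (inj₁ refl) ()
      sameLabel (inj₂ (s , refl)) e = sym (proj₂ (σ-injective (just-injective e)))

  no-short-cycle : ∀ m f → 3 ≤ m → m < g → ¬ Cycle nb m f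
  no-short-cycle m@(suc _) f 3≤m m<g cy = <⇒≢ m<g (CycleWalk.m≡g 3≤m (<⇒≤ m<g) f cy)

  3≤g : 3 ≤ g
  3≤g = ≤-trans (n≤1+n 3) 4≤g

  -- A monotone `g`-cycle visits every position once, so up to rotation and reversal it is a section
  -- `τ`. Its letters can only come from `cutUp` steps, because `loop` keeps the position and
  -- `cutDown` lowers it.
  module Section (τ : Fin g → T) (cy : Cycle nb g (λ y → τ y , y)) where

    open CycleWalk 3≤g ≤-refl (λ y → τ y , y) cy

    private
      X≡ : ∀ {n} → n < g → X n ≡ n
      X≡ {n} n<g = trans (toℕ-mod n g) (m<n⇒m%n≡m n<g)

      rises : ∀ {n} → Up n
      rises {n} = begin
        suc (toℕ (n mod g)) % g     ≡⟨ cong (λ k → suc k % g) (toℕ-mod n g) ⟩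
        suc (n % g) % g             ≡⟨ ≈-+ {a = 1} refl (%-≈ n) ⟩
        suc n % g                   ≡⟨ %-≈ (suc n) ⟨
        suc n % g % g               ≡⟨ cong (_% g) (toℕ-mod (suc n) g) ⟨
        toℕ (suc n mod g) % g       ∎
        where open ≡-Reasoning

      not-falling : ∀ {n} → ¬ Down n
      not-falling {n} dn = shifted-≉ 2 {X n} z<s 3≤g (trans (≈-+ {a = 1} refl (rises {n})) (sym dn))

      level : ∀ {n} → ¬ X (suc n) ≡ X n
      level {n} e = shifted-≉ 1 {X n} z<s (≤-trans (s≤s (s≤s z≤n)) 4≤g) (trans (rises {n}) (cong (_% g) e))

      letter-cut : ∀ {n a} → n < g → letter n ≡ just a → ∃ λ s → ∃ λ ℓ → a ≡ σ s ℓ × toℕ ℓ < cuts × n ≡ edge s (pos ℓ)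
      letter-cut {n} n<g e with subst (λ u → Step (n mod g) u (suc n mod g)) e (letter-step n)
      ... | cutUp s ℓ c p _ = s , ℓ , refl , c , trans (sym (X≡ n<g)) p
      ... | cutDown s ℓ c _ dn = contradiction dn not-falling
      ... | loop ℓ p _ _ = contradiction (cong toℕ p) level

      t : ℕ → T
      t n = τ (n mod g)

      τ≡t : ∀ y → τ y ≡ t (toℕ y)
      τ≡t y = cong τ (sym (toℕ-mod-id y))

      t₀ = t 0

      cut-positions : ∀ s {ℓ i j} → i ≡ edge s (pos ℓ) → j ≡ edge (not s) (pos ℓ) → i < j → s ≡ true
      cut-positions true _ _ _ = refl
      cut-positions false refl refl lt = contradiction (m≤m+n _ h) (<⇒≱ lt)

      bending : ∀ ℓ → letter (pos ℓ) ≡ just (σ true ℓ) → letter (pos ℓ + h) ≡ just (σ false ℓ) →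
        (∀ n → n < g → n ≢ pos ℓ → n ≢ pos ℓ + h → letter n ≡ nothing) →
        ∀ n → n < g → (n ≤ pos ℓ → t n ≡ t₀) × (pos ℓ < n → n ≤ pos ℓ + h → t n ≡ act (σ true ℓ) t₀) × (pos ℓ + h < n → t n ≡ t₀)
      bending ℓ v₁ v₂ silent zero _ = (λ _ → refl) , (λ ()) , (λ ())
      bending ℓ v₁ v₂ silent (suc n) n<g with <-trans (n<1+n n) n<g
      ... | n<g′ with bending ℓ v₁ v₂ silent n n<g′
      ... | below , between , above =
        (λ n<b → trans (quiet (<⇒≢ n<b) (<⇒≢ (≤-trans n<b (m≤m+n _ h)))) (below (<⇒≤ n<b))) ,
        (λ b<n n≤e → [ (λ b<n′ → trans (quiet (<⇒≢ b<n′ ∘ sym) (<⇒≢ n≤e)) (between b<n′ (<⇒≤ n≤e))) ,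
          (λ { refl → trans (sym (letter-acts n)) (cong₂ apply v₁ (below ≤-refl)) }) ]′ (m≤n⇒m<n∨m≡n (≤-pred b<n))) ,
        (λ e<n → [ (λ e<n′ → trans (quiet (<⇒≢ (≤-<-trans (m≤m+n _ h) e<n′) ∘ sym) (<⇒≢ e<n′ ∘ sym)) (above e<n′)) ,
          (λ { refl → trans (sym (letter-acts n)) (trans (cong₂ apply v₂ (between (pos<pos+h ℓ) ≤-refl)) (act-inv (σ true ℓ) t₀)) }) ]′ (m≤n⇒m<n∨m≡n (≤-pred e<n)))
        where
        quiet : n ≢ pos ℓ → n ≢ pos ℓ + h → t (suc n) ≡ t n
        quiet k≢ k≢′ = trans (sym (letter-acts n)) (cong (λ u → apply u (t n)) (silent n n<g′ k≢ k≢′))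

    private
      profile : ∀ ℓ y → (toℕ y ≤ pos ℓ → t (toℕ y) ≡ t₀) × (pos ℓ < toℕ y → toℕ y ≤ pos ℓ + h → t (toℕ y) ≡ act (σ true ℓ) t₀) × (pos ℓ + h < toℕ y → t (toℕ y) ≡ t₀) →
        t (toℕ y) ≡ bent t₀ ℓ y
      profile ℓ y (below , between , above) = choose (between? ℓ y)
        where
        choose : (P? : Dec (Between ℓ y)) → t (toℕ y) ≡ actIf P? (σ true ℓ) t₀
        choose (yes (lo , hi)) = between lo hi
        choose (no out) = [ below , (λ b<y → above (≰⇒> λ hi → out (b<y , hi))) ]′ (≤-<-connex (toℕ y) (pos ℓ))

    Classified : Set
    Classified = (∀ y → τ y ≡ t₀) ⊎ (∃ λ ℓ → toℕ ℓ < cuts × ∀ y → τ y ≡ bent t₀ ℓ y)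

    private
      twoLetters : ∀ s ℓ {i j} → toℕ ℓ < cuts → i ≡ edge s (pos ℓ) → j ≡ edge (not s) (pos ℓ) → i < j → s ≡ true →
        letter i ≡ just (σ s ℓ) → letter j ≡ just (σ (not s) ℓ) →
        (∀ n → n < g → n ≢ i → n ≢ j → letter n ≡ nothing) → Classified
      twoLetters .true ℓ c refl refl i<j refl vi vj silent =
        inj₂ (ℓ , c , λ y → trans (τ≡t y) (profile ℓ y (bending ℓ vi vj silent (toℕ y) (toℕ<n y))))

      sameCut : ∀ {s ℓ s′ ℓ′ j} → inv (σ s ℓ) ≡ σ s′ ℓ′ → j ≡ edge s′ (pos ℓ′) → j ≡ edge (not s) (pos ℓ)
      sameCut refl e = e

      fromLetters : Silent 0 g ⊎ (∃ λ i → ∃ λ j → ∃ λ a → i < j × j < g × letter i ≡ just a × letter j ≡ just (inv a) ×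
        (∀ n → n < g → n ≢ i → n ≢ j → letter n ≡ nothing)) → Classified
      fromLetters (inj₁ silent) = inj₁ λ y → trans (τ≡t y) (silent-t 0 (toℕ y) λ e e< → silent e (<-trans e< (toℕ<n y)))
      fromLetters (inj₂ (i , j , a , i<j , j<g , vi , vj , silent)) = cutAt (letter-cut (<-trans i<j j<g) vi) (letter-cut j<g vj) vi vj
        where
        cutAt : ∀ {a} → (∃ λ s → ∃ λ ℓ → a ≡ σ s ℓ × toℕ ℓ < cuts × i ≡ edge s (pos ℓ)) →
          (∃ λ s → ∃ λ ℓ → inv a ≡ σ s ℓ × toℕ ℓ < cuts × j ≡ edge s (pos ℓ)) →
          letter i ≡ just a → letter j ≡ just (inv a) → Classified
        cutAt (s , ℓ , refl , c , i≡) (s′ , ℓ′ , a≡ , _ , j≡) vi vj =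
          twoLetters s ℓ c i≡ (sameCut a≡ j≡) i<j (cut-positions s i≡ (sameCut a≡ j≡) i<j) vi vj silent

    classified : Classified
    classified = fromLetters (Outcome.letters outcome)

    complete : ∀ x → ∃ λ c → ∀ y → height (τ x , x) c y ≡ τ y
    complete x = from classified
      where
      bend : ∀ c {ℓ} → cutLabel c ≡ ℓ → (∀ y → τ y ≡ bent t₀ ℓ y) → ∀ y → height (τ x , x) (suc c) y ≡ τ y
      bend c {ℓ} refl bends y = trans (cong (λ u → bent u ℓ y) (trans (cong (actIf (between? ℓ x) (σ false ℓ)) (bends x)) (actIf-inv (between? ℓ x) (σ true ℓ) t₀))) (sym (bends y))
      from : Classified → ∃ λ c → ∀ y → height (τ x , x) c y ≡ τ y
      from (inj₁ flat) = zero , λ y → trans (flat x) (sym (flat y))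
      from (inj₂ (ℓ , ℓ<cuts , bends)) = suc (proj₁ (cutLabel-onto ℓ<cuts)) , bend _ (proj₂ (cutLabel-onto ℓ<cuts)) bends

  rising-complete : ∀ f → Cycle nb g f → (∀ i j → Consecutive g i j → suc (toℕ (proj₂ (f i))) ≈[ g ] toℕ (proj₂ (f j))) →
    ∀ i → ∃ λ c → cell (f i) c ≋ f
  rising-complete f cy rising i = finish (Section.complete τ cy′ x)
    where
    x₀ = toℕ (proj₂ (f (0 mod g)))
    r₀ : Fin g
    -- Minus the position found at index 0: after this rotation index and position agree.
    r₀ = (g ∸ x₀) mod g
    f′ : Fin g → Vertex
    f′ = f ∘ shift (toℕ r₀)
    height-at : ∀ n → x₀ + n ≈[ g ] toℕ (proj₂ (f (n mod g)))
    height-at zero = cong (_% g) (+-identityʳ x₀)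
    height-at (suc n) = trans (cong (_% g) (+-suc x₀ n)) (trans (≈-+ {a = 1} refl (height-at n)) (rising _ _ (mod-consecutive n g)))
    lies-over : ∀ y → proj₂ (f′ y) ≡ y
    lies-over y = Fin-≈ (begin
      toℕ (proj₂ (f′ y)) % g       ≡⟨ height-at (toℕ r₀ + toℕ y) ⟨
      (x₀ + (toℕ r₀ + toℕ y)) % g   ≡⟨ cong (λ k → (x₀ + (k + toℕ y)) % g) (toℕ-mod (g ∸ x₀) g) ⟩
      (x₀ + ((g ∸ x₀) % g + toℕ y)) % g  ≡⟨ ≈-+ {a = x₀} refl (≈-+ {c = toℕ y} (%-≈ (g ∸ x₀)) refl) ⟩
      (x₀ + (g ∸ x₀ + toℕ y)) % g  ≡⟨ cong (_% g) (+-assoc x₀ (g ∸ x₀) (toℕ y)) ⟨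
      (x₀ + (g ∸ x₀) + toℕ y) % g  ≡⟨ cong (λ k → (k + toℕ y) % g) (m+[n∸m]≡n (<⇒≤ (toℕ<n (proj₂ (f (0 mod g)))))) ⟩
      (g + toℕ y) % g              ≡⟨ cong (_% g) (+-comm g (toℕ y)) ⟩
      (toℕ y + g) % g              ≡⟨ ≈-+g (toℕ y) ⟩
      toℕ y % g                    ∎)
      where open ≡-Reasoning
    τ : Fin g → T
    τ y = proj₁ (f′ y)
    over : ∀ y → (τ y , y) ≡ f′ y
    over y = cong (τ y ,_) (sym (lies-over y))
    cy′ : Cycle nb g (λ y → τ y , y)
    cy′ = (λ i j e → cong proj₂ e) ,
      λ y y′ con → subst₂ (Adjacent nb) (sym (over y)) (sym (over y′)) (proj₂ (cycle-shift nb (toℕ r₀) cy) y y′ con)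
    x = shift (g ∸ toℕ r₀) i
    at-i : (τ x , x) ≡ f i
    at-i = trans (over x) (cong f (unshift r₀ i))
    finish : (∃ λ c → ∀ y → height (τ x , x) c y ≡ τ y) → ∃ λ c → cell (f i) c ≋ f
    finish (c , same) = c , ≋-trans
      (≗⇒≋ λ y → trans (cong (λ a → cell a c y) (sym at-i)) (trans (cong (_, y) (same y)) (over y))) (rotate-≋ f r₀)

  cell-complete : ∀ f → Cycle nb g f → ∀ i → ∃ λ c → cell (f i) c ≋ f
  cell-complete f cy i = [ (λ rising → rising-complete f cy rising i) , fall ]′ (CycleWalk.rising⊎falling 3≤g ≤-refl f cy)
    where
    fall : (∀ i j → Consecutive g i j → toℕ (proj₂ (f i)) ≈[ g ] suc (toℕ (proj₂ (f j)))) → ∃ λ c → cell (f i) c ≋ f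
    fall falling = turn (rising-complete (f ∘ opposite) (reverse-cycle cy) (λ i j con → sym (falling _ _ (opposite-consecutive con))) (opposite i))
      where
      turn : (∃ λ c → cell (f (opposite (opposite i))) c ≋ (f ∘ opposite)) → ∃ λ c → cell (f i) c ≋ f
      turn (c , same) = c , ≋-trans (subst (λ k → cell (f k) c ≋ (f ∘ opposite)) (opposite-involutive i) same) (reverse-≋ f)

  cutCells : CellSystem (2 + r) g (suc cuts)
  cutCells = record
    { index = ↔-sym *↔×
    ; origin = origin , 0 mod g
    ; nb = nb
    ; nb-injective = nb-injective
    ; nb-symmetric = nb-symmetric
    ; nb-irreflexive = nb-irreflexive
    ; cell = cell
    ; cell-cycle = cell-cycle
    ; cell-through = λ (t , x) c → x , cong (_, x) (height-self t x c)
    ; cell-separated = cell-separated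
    ; no-short-cycle = no-short-cycle
    ; cell-complete = cell-complete
    }

-- Choice of the cuts

half-+-≤ : ∀ g → ⌊ g /2⌋ + ⌊ g /2⌋ ≤ g
half-+-≤ g = ≤-trans (+-monoʳ-≤ ⌊ g /2⌋ (⌊n/2⌋≤⌈n/2⌉ g)) (≤-reflexive (⌊n/2⌋+⌈n/2⌉≡n g))

≤-1+half-+ : ∀ g → g ≤ suc (⌊ g /2⌋ + ⌊ g /2⌋)
≤-1+half-+ zero = z≤n
≤-1+half-+ (suc zero) = s≤s z≤n
≤-1+half-+ (suc (suc g)) = s≤s (≤-trans (s≤s (≤-1+half-+ g)) (s≤s (≤-reflexive (sym (+-suc ⌊ g /2⌋ ⌊ g /2⌋)))))

module Cuts (g : ℕ) (4≤g : 4 ≤ g) where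

  private
    h = ⌊ g /2⌋

  instance
    g≢0 : NonZero g
    g≢0 = >-nonZero (≤-trans (s≤s z≤n) 4≤g)

  open Positions g h public

  cutSystem : ∀ r cuts → cuts ≤ suc r → (pos : Fin (suc r) → ℕ) → (∀ ℓ → pos ℓ + h < g) →
    (skip : Fin g → Fin (suc r)) → (∀ x → ¬ (toℕ (skip x) < cuts × Near x (pos (skip x)))) → CellSystem (2 + r) g (suc cuts)
  cutSystem r cuts cuts≤ pos pos< skip skip-far = CutGraph.cutCells g h (⌊n/2⌋-mono 4≤g) (half-+-≤ g) (≤-1+half-+ g)
    r cuts cuts≤ pos pos< skip skip-far (Construction.freeAction inv inv-involutive code code-injective g)
    where open Alphabet g r

  -- At least one label is not a cut, and all vertices may skip the last one. The cuts can all lie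
  -- at 0, for they are told apart by their letters.
  sparse : ∀ r cuts → cuts ≤ r → CellSystem (2 + r) g (suc cuts)
  sparse r cuts cuts≤r = cutSystem r cuts (m≤n⇒m≤1+n cuts≤r) (λ _ → 0) (λ _ → half<) (λ _ → fromℕ r)
    λ x (r<cuts , _) → <⇒≱ (subst (_< cuts) (toℕ-fromℕ r) r<cuts) cuts≤r
    where
    half< : h < g
    half< = ≤-trans (+-monoˡ-≤ h (≤-trans (s≤s z≤n) (⌊n/2⌋-mono 4≤g))) (half-+-≤ g)

  near⇒interval : ∀ {x b} → suc (b + h) < g → Near x b → ∃ λ s → edge s b ≤ toℕ x × toℕ x ≤ suc (edge s b)
  near⇒interval _ (s , inj₁ e) = s , ≤-reflexive (sym e) , ≤-trans (≤-reflexive e) (n≤1+n _)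
  near⇒interval {x} {b} b<g (s , inj₂ e) with ≈-small (toℕ<n x) (suc-edge< s) e
    where
    suc-edge< : ∀ s → suc (edge s b) < g
    suc-edge< true = ≤-<-trans (s≤s (m≤m+n b h)) b<g
    suc-edge< false = b<g
  ... | e′ = s , ≤-trans (n≤1+n _) (≤-reflexive (sym e′)) , ≤-reflexive e′

  module _ (8≤g : 8 ≤ g) where

    private
      4≤h : 4 ≤ h
      4≤h = ⌊n/2⌋-mono 8≤g

      4+h≤g : 4 + h ≤ g
      4+h≤g = ≤-trans (+-monoˡ-≤ h 4≤h) (half-+-≤ g)

      disjoint : ∀ {x} → Near x 0 → ¬ Near x 2
      disjoint {x} n₀ n₂ with near⇒interval (≤-trans (s≤s (s≤s (m≤n+m h 2))) 4+h≤g) n₀ | near⇒interval 4+h≤g n₂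
      ... | true , _ , hi | true , lo , _ = <⇒≱ lo hi
      ... | true , _ , hi | false , lo , _ = <⇒≱ (≤-trans (m≤m+n 2 h) lo) hi
      ... | false , lo , _ | true , _ , hi = <⇒≱ (≤-trans 4≤h lo) hi
      ... | false , _ , hi | false , lo , _ = <⇒≱ lo hi

    -- The cuts at 0 and 2 touch 0, 1, h, h + 1 and 2, 3, h + 2, h + 3. For h ≥ 4 these are
    -- disjoint, so each vertex can skip one of the two; any further cuts are placed at 0.
    dense : ∀ r → CellSystem (3 + r) g (3 + r)
    dense r = cutSystem (suc r) (2 + r) ≤-refl pos (λ ℓ → ≤-trans (s≤s (+-monoˡ-≤ h (pos≤2 ℓ))) (≤-trans (n≤1+n _) 4+h≤g)) (λ x → skip x (near? x 0)) (λ x → far x (near? x 0) ∘ proj₂)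
      where
      pos : Fin (2 + r) → ℕ
      pos zero = 0
      pos (suc zero) = 2
      pos (suc (suc _)) = 0
      pos≤2 : ∀ ℓ → pos ℓ ≤ 2
      pos≤2 zero = z≤n
      pos≤2 (suc zero) = ≤-refl
      pos≤2 (suc (suc _)) = z≤n
      skip : ∀ x → Dec (Near x 0) → Fin (2 + r)
      skip x (yes _) = suc zero
      skip x (no _) = zero
      far : ∀ x (n? : Dec (Near x 0)) → ¬ Near x (pos (skip x n?))
      far x (yes n₀) = disjoint n₀
      far x (no ¬n₀) = ¬n₀

  -- Three cuts without a common vertex, for g = 6 and 7.
  threeCuts : (∀ c → toℕ {3} c + h < g) → (∀ x → ¬ Near x (toℕ (suc (toℕ x) mod 3))) → ∀ r → CellSystem (4 + r) g (4 + r)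
  -- For h = 3 the cut at b touches b, b + 1, b + 3 and b + 4, whose residues modulo 3 are those of
  -- b and b + 1. So the cut at the residue of x + 1 misses x. For g = 6 this survives the reduction
  -- modulo g, and for g = 7 no end wraps around.
  threeCuts fits clear r = cutSystem (2 + r) (3 + r) ≤-refl pos pos< (λ x → low (suc (toℕ x) mod 3))
    λ x (_ , near) → clear x (subst (Near x) (pos-low (suc (toℕ x) mod 3)) near)
    where
    low : Fin 3 → Fin (3 + r)
    low zero = zero
    low (suc zero) = suc zero
    low (suc (suc zero)) = suc (suc zero)
    pos : Fin (3 + r) → ℕ
    pos (suc zero) = 1
    pos (suc (suc zero)) = 2
    pos _ = 0
    pos-low : ∀ c → pos (low c) ≡ toℕ c
    pos-low zero = refl
    pos-low (suc zero) = refl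
    pos-low (suc (suc zero)) = refl
    pos< : ∀ ℓ → pos ℓ + h < g
    pos< zero = fits zero
    pos< (suc zero) = fits (suc zero)
    pos< (suc (suc zero)) = fits (suc (suc zero))
    pos< (suc (suc (suc _))) = fits zero

dense₆ : ∀ r → CellSystem (4 + r) 6 (4 + r)
dense₆ = threeCuts (from-yes (all? λ (c : Fin 3) → toℕ c + 3 <? 6)) (from-yes (all? λ x → ¬? (near? x (toℕ (suc (toℕ x) mod 3)))))
  where open Cuts 6 (from-yes (4 ≤? 6))

dense₇ : ∀ r → CellSystem (4 + r) 7 (4 + r)
dense₇ = threeCuts (from-yes (all? λ (c : Fin 3) → toℕ c + 3 <? 7)) (from-yes (all? λ x → ¬? (near? x (toℕ (suc (toℕ x) mod 3)))))
  where open Cuts 7 (from-yes (4 ≤? 7))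

-- Assembly of the parameter cases

pad : ∀ {k l} n → CellSystem k 3 l → CellSystem (n + k) 3 l
pad zero 𝒞 = 𝒞
pad (suc n) 𝒞 = CartesianProduct.product K₂ (pad n 𝒞)

padTo : ∀ {k k′ l} → k ≤ k′ → CellSystem k 3 l → CellSystem k′ 3 l
padTo {k} {k′} {l} k≤k′ 𝒞 = subst (λ n → CellSystem n 3 l) (m∸n+n≡m k≤k′) (pad (k′ ∸ k) 𝒞)

-- Degrees and numbers of triangles both add up in products, so the values 3, 4, 5 and steps of 3 by
-- factors `K₄` reach every number from 3 on.
triangular : ∀ n → CellSystem (3 + n) 3 (3 + n)
triangular 0 = K₄
triangular 1 = octahedron
triangular 2 = icosahedron
triangular (suc (suc (suc n))) = CartesianProduct.product K₄ (triangular n)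

oneCell : ∀ k g → 3 ≤ k → 3 ≤ g → CellSystem k g 1
oneCell k g 3≤k 3≤g with m≤n⇒m<n∨m≡n 3≤g
oneCell (suc (suc r)) g 3≤k 3≤g | inj₁ 4≤g = Cuts.sparse g 4≤g r 0 z≤n
oneCell (suc zero) g (s≤s ()) 3≤g | inj₁ 4≤g
oneCell k .3 3≤k 3≤g | inj₂ refl = padTo (≤-trans (n≤1+n 2) 3≤k) K₃

twoCells : ∀ k g → 4 ≤ k → 3 ≤ g → CellSystem k g 2
twoCells k g 4≤k 3≤g with m≤n⇒m<n∨m≡n 3≤g
twoCells (suc (suc r)) g (s≤s (s≤s 2≤r)) 3≤g | inj₁ 4≤g = Cuts.sparse g 4≤g r 1 (≤-trans (s≤s z≤n) 2≤r)
twoCells k .3 4≤k 3≤g | inj₂ refl = padTo 4≤k (CartesianProduct.product K₃ K₃)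

denseCells : ∀ r g → 6 ≤ g → CellSystem (3 + r) g (3 + r)
denseCells r g 6≤g with m≤n⇒m<n∨m≡n 6≤g
denseCells zero .6 6≤g | inj₂ refl = honeycomb
denseCells (suc r) .6 6≤g | inj₂ refl = dense₆ r
denseCells r g 6≤g | inj₁ 7≤g with m≤n⇒m<n∨m≡n 7≤g
denseCells zero .7 6≤g | inj₁ 7≤g | inj₂ refl = heptagonal
denseCells (suc r) .7 6≤g | inj₁ 7≤g | inj₂ refl = dense₇ r
denseCells r g 6≤g | inj₁ 7≤g | inj₁ 8≤g = Cuts.dense g (≤-trans (m≤n+m 4 4) 8≤g) 8≤g r

girth-cases : ∀ {g} → 3 ≤ g → g ≢ 4 → g ≢ 5 → g ≡ 3 ⊎ 6 ≤ g
girth-cases 3≤g g≢4 g≢5 with m≤n⇒m<n∨m≡n 3≤g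
... | inj₂ refl = inj₁ refl
... | inj₁ 4≤g = inj₂ (≤∧≢⇒< (≤∧≢⇒< 4≤g (g≢4 ∘ sym)) (g≢5 ∘ sym))

manyCells : ∀ l k g → 3 ≤ l → l ≤ k → 3 ≤ g → g ≢ 4 → g ≢ 5 → CellSystem k g l
manyCells l k g (s≤s (s≤s (s≤s {n = n} _))) l≤k 3≤g g≢4 g≢5 with girth-cases 3≤g g≢4 g≢5
... | inj₁ refl = padTo l≤k (triangular n)
... | inj₂ 6≤g with m≤n⇒m<n∨m≡n l≤k
... | inj₂ refl = denseCells n g 6≤g
-- A degree above λ leaves a label that is not a cut.
... | inj₁ (s≤s (s≤s {n = r} l≤r)) = Cuts.sparse g (≤-trans (m≤n+m 4 2) 6≤g) r (2 + n) l≤r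

theorem4 : (∀ k g → 3 ≤ k → 3 ≤ g → InfinitelyManyVGR k g 1) ×
    (∀ k g → 4 ≤ k → 3 ≤ g → InfinitelyManyVGR k g 2) ×
    (∀ λ' k g → 3 ≤ λ' → λ' ≤ k → 3 ≤ g → g ≢ 4 → g ≢ 5 →
    InfinitelyManyVGR k g λ')
theorem4 =
  (λ k g 3≤k 3≤g → cellSystem⇒infinitelyMany 3≤g z<s (oneCell k g 3≤k 3≤g)) ,
  (λ k g 4≤k 3≤g → cellSystem⇒infinitelyMany 3≤g z<s (twoCells k g 4≤k 3≤g)) ,
  (λ l k g 3≤l l≤k 3≤g g≢4 g≢5 → cellSystem⇒infinitelyMany 3≤g (≤-trans (s≤s z≤n) 3≤l) (manyCells l k g 3≤l l≤k 3≤g g≢4 g≢5))
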